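{- Let $s\ge 2$ and $n\ge 1$ be integers and let $G$ be a metric star consisting of $s$ spikes of length one. For every graph $G_w$ obtained from $G$ by adding $ns$ wormholes, $\mathrm{diam}(G_w)\ge 2/(2n+1)$. Moreover, there is a choice of $ns$ wormholes for which $\mathrm{diam}(G_w)=2/(2n+1)$, and this can be achieved by a fusion, that is, by identifying $ns+1$ points of $G$ to a single point.
   Context: A metric graph is a finite edge-weighted graph regarded as a metric space in which all points in the interior of each edge are included and each edge is locally isometric to an interval whose length is the edge weight; $\mathrm{diam}(G)=\max_{x,y\in G} d_G(x,y)$ over all points of $G$, where $d_G(x,y)$ is the minimum length of a path from $x$ to $y$. The metric star with $s$ spikes of length one consists of $s$ intervals of length $1$ glued at a common endpoint. A wormhole is a pair of points of $G$ (arbitrary points, not necessarily vertices); adding a wormhole means identifying its two points, equivalently adding an edge of length zero between them. $G_w$ is the metric graph obtained after all the identifications. Different wormholes may share points. The fusion of $k+1$ points is the same as adding the $k$ wormholes joining consecutive points in some ordering of them. -}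

module Defs where

open import Data.Nat as ℕ using (ℕ; zero; suc)
open import Data.Fin using (Fin; zero; suc; inject₁)
open import Data.Product using (_×_; _,_; Σ-syntax; ∃-syntax; ∃₂; proj₁; proj₂)
open import Data.Rational as ℚ using (ℚ; 0ℚ; 1ℚ; ½)
import Data.Nat.Properties as ℕₚ
import Data.Rational.Properties as ℚₚ
open import Data.Rational.Solver using (module +-*-Solver)
open import Data.Sum using (inj₁; inj₂)
open import Relation.Binary.PropositionalEquality
  using (_≡_; refl; sym; cong; subst)

-- Real numbers are Cauchy sequences of rationals, compared up to _≈_.

record ℝ : Set where
  constructor mkℝ
  field
    seq    : ℕ → ℚ
    cauchy : ∀ ε → 0ℚ ℚ.< ε → ∃[ N ] (∀ m n → N ℕ.≤ m → N ℕ.≤ n →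
               ℚ.∣ seq m ℚ.- seq n ∣ ℚ.≤ ε)

open ℝ public

infix 4 _≤_ _<_ _≈_

_≤_ : ℝ → ℝ → Set
x ≤ y = ∀ ε → 0ℚ ℚ.< ε → ∃[ N ] (∀ n → N ℕ.≤ n → seq x n ℚ.≤ seq y n ℚ.+ ε)

_<_ : ℝ → ℝ → Set
x < y = ∃[ ε ] 0ℚ ℚ.< ε × ∃[ N ] (∀ n → N ℕ.≤ n → seq x n ℚ.+ ε ℚ.≤ seq y n)

_≈_ : ℝ → ℝ → Set
x ≈ y = x ≤ y × y ≤ x

fromℚ : ℚ → ℝ
fromℚ q = mkℝ (λ _ → q) λ ε 0<ε → 0 , λ _ _ _ _ →
  subst (λ d → ℚ.∣ d ∣ ℚ.≤ ε) (sym (ℚₚ.+-inverseʳ q)) (ℚₚ.<⇒≤ 0<ε)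

0ℝ 1ℝ : ℝ
0ℝ = fromℚ 0ℚ
1ℝ = fromℚ 1ℚ

infixl 6 _+_ _-_
infix  8 -_

_+_ : ℝ → ℝ → ℝ
x + y = mkℝ (λ n → seq x n ℚ.+ seq y n) λ ε 0<ε →
  let 0<ε/2      = subst (ℚ._< ½ ℚ.* ε) (ℚₚ.*-zeroʳ ½) (ℚₚ.*-monoʳ-<-pos ½ 0<ε)
      (M , M-ok) = cauchy x (½ ℚ.* ε) 0<ε/2
      (N , N-ok) = cauchy y (½ ℚ.* ε) 0<ε/2
  in M ℕ.⊔ N , λ m n m≥ n≥ → begin
    ℚ.∣ (seq x m ℚ.+ seq y m) ℚ.- (seq x n ℚ.+ seq y n) ∣
      ≡⟨ cong ℚ.∣_∣ (swap (seq x m) (seq y m) (seq x n) (seq y n)) ⟩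
    ℚ.∣ (seq x m ℚ.- seq x n) ℚ.+ (seq y m ℚ.- seq y n) ∣
      ≤⟨ ℚₚ.∣p+q∣≤∣p∣+∣q∣ (seq x m ℚ.- seq x n) (seq y m ℚ.- seq y n) ⟩
    ℚ.∣ seq x m ℚ.- seq x n ∣ ℚ.+ ℚ.∣ seq y m ℚ.- seq y n ∣
      ≤⟨ ℚₚ.+-mono-≤ (M-ok m n (ℕₚ.m⊔n≤o⇒m≤o M N m≥) (ℕₚ.m⊔n≤o⇒m≤o M N n≥))
                     (N-ok m n (ℕₚ.m⊔n≤o⇒n≤o M N m≥) (ℕₚ.m⊔n≤o⇒n≤o M N n≥)) ⟩
    ½ ℚ.* ε ℚ.+ ½ ℚ.* ε
      ≡⟨ halves ε ⟩
    ε ∎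
  where
  open ℚₚ.≤-Reasoning
  open +-*-Solver
  swap : ∀ a b c d → (a ℚ.+ b) ℚ.- (c ℚ.+ d) ≡ (a ℚ.- c) ℚ.+ (b ℚ.- d)
  swap = solve 4 (λ a b c d → (a :+ b) :- (c :+ d) := (a :- c) :+ (b :- d)) refl
  halves : ∀ e → ½ ℚ.* e ℚ.+ ½ ℚ.* e ≡ e
  halves = solve 1 (λ e → con ½ :* e :+ con ½ :* e := e) refl

-_ : ℝ → ℝ
- x = mkℝ (λ n → ℚ.- seq x n) λ ε 0<ε →
  let (N , N-ok) = cauchy x ε 0<ε
  in N , λ m n m≥ n≥ →
    subst (λ d → ℚ.∣ d ∣ ℚ.≤ ε) (swap (seq x n) (seq x m)) (N-ok n m n≥ m≥)
  where
  open +-*-Solver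
  swap : ∀ a b → a ℚ.- b ≡ ℚ.- b ℚ.- ℚ.- a
  swap = solve 2 (λ a b → a :- b := :- b :- :- a) refl

_-_ : ℝ → ℝ → ℝ
x - y = x + - y

∣_∣ : ℝ → ℝ
∣ x ∣ = mkℝ (λ n → ℚ.∣ seq x n ∣) λ ε 0<ε →
  let (N , N-ok) = cauchy x ε 0<ε
  in N , λ m n m≥ n≥ →
    ℚₚ.≤-trans (reverse-triangle (seq x m) (seq x n)) (N-ok m n m≥ n≥)
  where
  open +-*-Solver
  split : ∀ a b → a ≡ (a ℚ.- b) ℚ.+ b
  split = solve 2 (λ a b → a := (a :- b) :+ b) refl
  cancel : ∀ a b → (a ℚ.+ b) ℚ.- b ≡ a
  cancel = solve 2 (λ a b → (a :+ b) :- b := a) refl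
  flip : ∀ a b → ℚ.- (a ℚ.- b) ≡ b ℚ.- a
  flip = solve 2 (λ a b → :- (a :- b) := b :- a) refl

  half : ∀ a b → ℚ.∣ a ∣ ℚ.- ℚ.∣ b ∣ ℚ.≤ ℚ.∣ a ℚ.- b ∣
  half a b = begin
    ℚ.∣ a ∣ ℚ.- ℚ.∣ b ∣
      ≡⟨ cong (λ c → ℚ.∣ c ∣ ℚ.- ℚ.∣ b ∣) (split a b) ⟩
    ℚ.∣ (a ℚ.- b) ℚ.+ b ∣ ℚ.- ℚ.∣ b ∣
      ≤⟨ ℚₚ.+-monoˡ-≤ (ℚ.- ℚ.∣ b ∣) (ℚₚ.∣p+q∣≤∣p∣+∣q∣ (a ℚ.- b) b) ⟩
    (ℚ.∣ a ℚ.- b ∣ ℚ.+ ℚ.∣ b ∣) ℚ.- ℚ.∣ b ∣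
      ≡⟨ cancel ℚ.∣ a ℚ.- b ∣ ℚ.∣ b ∣ ⟩
    ℚ.∣ a ℚ.- b ∣ ∎
    where open ℚₚ.≤-Reasoning

  reverse-triangle : ∀ a b → ℚ.∣ ℚ.∣ a ∣ ℚ.- ℚ.∣ b ∣ ∣ ℚ.≤ ℚ.∣ a ℚ.- b ∣
  reverse-triangle a b with ℚₚ.∣p∣≡p∨∣p∣≡-p (ℚ.∣ a ∣ ℚ.- ℚ.∣ b ∣)
  ... | inj₁ eq = subst (ℚ._≤ ℚ.∣ a ℚ.- b ∣) (sym eq) (half a b)
  ... | inj₂ eq = begin
    ℚ.∣ ℚ.∣ a ∣ ℚ.- ℚ.∣ b ∣ ∣  ≡⟨ eq ⟩
    ℚ.- (ℚ.∣ a ∣ ℚ.- ℚ.∣ b ∣)  ≡⟨ flip ℚ.∣ a ∣ ℚ.∣ b ∣ ⟩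
    ℚ.∣ b ∣ ℚ.- ℚ.∣ a ∣        ≤⟨ half b a ⟩
    ℚ.∣ b ℚ.- a ∣              ≡⟨ cong ℚ.∣_∣ (sym (flip a b)) ⟩
    ℚ.∣ ℚ.- (a ℚ.- b) ∣        ≡⟨ ℚₚ.∣-p∣≡∣p∣ (a ℚ.- b) ⟩
    ℚ.∣ a ℚ.- b ∣              ∎
    where open ℚₚ.≤-Reasoning

IsMinimum IsMaximum : (ℝ → Set) → ℝ → Set
IsMinimum P r = P r × (∀ q → P q → r ≤ q)
IsMaximum P r = P r × (∀ q → P q → q ≤ r)

record MetricGraph : Set where
  field
    #vertices #edges : ℕ
    source target    : Fin #edges → Fin #vertices
    weight           : Fin #edges → ℝ
    weight-positive  : ∀ e → 0ℝ < weight e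

module _ (G : MetricGraph) where
  open MetricGraph G

  -- `on e t` is the point of the closed edge e at distance t (along e) from
  -- source e.  The ends of the edge are glued to its vertices by the
  -- length-zero steps at-source and at-target below, so a vertex has several
  -- representatives, at distance zero from one another.
  data Point : Set where
    vertex : Fin #vertices → Point
    on     : (e : Fin #edges) (t : ℝ) → 0ℝ ≤ t → t ≤ weight e → Point

  Wormholes : ℕ → Set
  Wormholes k = Fin k → Point × Point

-- Paths in the graph G_w obtained from G by adding the wormholes W, indexed by
-- their length.  Within an edge only geodesic pieces are used, which does not
-- affect the minimum length.

data Step (G : MetricGraph) {k} (W : Wormholes G k) :
          Point G → Point G → ℝ → Set where
  along     : ∀ {e t u 0≤t t≤w 0≤u u≤w} →
              Step G W (on e t 0≤t t≤w) (on e u 0≤u u≤w) ∣ t - u ∣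
  at-source : ∀ {e t 0≤t t≤w} → t ≈ 0ℝ →
              Step G W (vertex (MetricGraph.source G e)) (on e t 0≤t t≤w) 0ℝ
  at-target : ∀ {e t 0≤t t≤w} → t ≈ MetricGraph.weight G e →
              Step G W (vertex (MetricGraph.target G e)) (on e t 0≤t t≤w) 0ℝ
  wormhole  : ∀ i → Step G W (proj₁ (W i)) (proj₂ (W i)) 0ℝ
  reverse   : ∀ {x y r} → Step G W x y r → Step G W y x r

infixr 5 _∷_

data Path (G : MetricGraph) {k} (W : Wormholes G k) :
          Point G → Point G → ℝ → Set where
  []  : ∀ {x} → Path G W x x 0ℝ
  _∷_ : ∀ {x y z r r′} → Step G W x y r → Path G W y z r′ →
        Path G W x z (r + r′)

module _ (G : MetricGraph) {k} (W : Wormholes G k) where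

  HasPathOfLength : Point G → Point G → ℝ → Set
  HasPathOfLength x y r = ∃[ r′ ] r′ ≈ r × Path G W x y r′

  IsDistance : Point G → Point G → ℝ → Set
  IsDistance x y = IsMinimum (HasPathOfLength x y)

  IsDiameter : ℝ → Set
  IsDiameter = IsMaximum (λ r → ∃₂ λ x y → IsDistance x y r)

SamePoint : (G : MetricGraph) → Point G → Point G → Set
SamePoint G x y = IsDistance G {0} (λ ()) x y 0ℝ

-- W is the fusion of k + 1 distinct points of G: its wormholes join the
-- consecutive points in some ordering p of them.
IsFusion : (G : MetricGraph) {k : ℕ} → Wormholes G k → Set
IsFusion G {k} W = Σ[ p ∈ (Fin (suc k) → Point G) ]
  (∀ i j → SamePoint G (p i) (p j) → i ≡ j) ×
  (∀ (i : Fin k) → W i ≡ (p (inject₁ i) , p (suc i)))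

star : ℕ → MetricGraph
star s = record
  { #vertices       = suc s
  ; #edges          = s
  ; source          = λ _ → zero
  ; target          = suc
  ; weight          = λ _ → 1ℝ
  ; weight-positive = λ _ → 1ℚ , ℚₚ.positive⁻¹ 1ℚ , 0 , λ _ _ → ℚₚ.≤-refl
  }

{-# OPTIONS --safe #-}
-- Call a function on the star a potential if it is 1-Lipschitz on each spike
-- and vanishes at the centre.  Along a path, a potential changes by at most the
-- length of the path plus the jumps at the wormholes used, counted with sign.
--
-- Lower bound.  With H = 2/(2n+1), the star contains ns + 1 disjoint segments of
-- length H: n on each spike, outermost first, and one through the centre.  If
-- the ends of each segment were joined by a path shorter than H, then ns + 1
-- vectors of wormhole usage in ℚ^(ns) would be linearly dependent, say with
-- coefficients c i.  In the combination Σ c i of the paths the wormholes cancel,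
-- which contradicts the potential of slope sign (c i) along segment i.  So some
-- segment is a shortest path between its ends.
--
-- Upper bound.  Fuse the centre and the points at distances H, 2H, …, nH from it
-- on every spike; every point is within H/2 of one of these.
module Submission where

open import Defs
open import Data.Nat as ℕ using (ℕ; suc)
open import Data.Integer using (+_)
open import Data.Rational using (_/_)
open import Data.Product using (_×_; Σ-syntax)

open import Algebra.Bundles using (CommutativeRing)
open import Data.Fin using (Fin; zero; suc; inject₁; punchIn; combine; remQuot)
open import Data.Fin.Induction using (<-weakInduction)
open import Data.Fin.Properties using (any?; sequence; combine-remQuot; remQuot-combine; _≟_)
import Data.Integer as ℤ
import Data.Integer.Properties as ℤₚ
open import Data.Integer.Solver using () renaming (module +-*-Solver to ℤ-Solver)
open import Data.Nat using (zero)
import Data.Nat.Properties as ℕₚ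
open import Data.Product using (_,_; ∃-syntax; proj₁; proj₂)
open import Data.Rational as ℚ using (ℚ; 0ℚ; 1ℚ; ½)
import Data.Rational.Properties as ℚₚ
open import Data.Rational.Solver using (module +-*-Solver)
open import Data.Rational.Unnormalised as ℚᵘ using (mkℚᵘ; *≡*)
import Data.Rational.Unnormalised.Properties as ℚᵘₚ
open import Data.Sum using (_⊎_; inj₁; inj₂; [_,_]′)
open import Data.Vec.Functional using (insertAt)
open import Data.Vec.Functional.Properties using (insertAt-lookup; insertAt-punchIn)
open import Effect.Monad using (RawMonad)
open import Function using (_∘_)
open import Relation.Binary.Definitions using (tri<; tri≈; tri>)
open import Relation.Binary.PropositionalEquality
  using (_≡_; _≢_; refl; sym; trans; cong; cong₂; subst; module ≡-Reasoning)
open import Relation.Nullary using (¬_; yes; no; ¬?; contradiction)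
open import Relation.Nullary.Decidable using (decidable-stable)
open import Relation.Nullary.Negation using (¬¬-Monad)
open import Algebra.Properties.Group ℚₚ.+-0-group
  using () renaming (∙-cancelˡ to +-cancelˡ; ∙-cancelʳ to +-cancelʳ)
open import Algebra.Properties.Semiring.Sum (CommutativeRing.semiring ℚₚ.+-*-commutativeRing)
  using (sum; sum-cong-≗; sum-remove; sum-replicate-zero; ∑-distrib-+; ∑-comm; *-distribˡ-sum; *-distribʳ-sum)

open +-*-Solver using (solve; _:=_; _:+_; _:*_; _:-_; :-_; con)

-- Rational inequalities

p+[q-p]≡q : ∀ p q → p ℚ.+ (q ℚ.- p) ≡ q
p+[q-p]≡q = solve 2 (λ p q → p :+ (q :- p) := q) refl

-- The workhorse for linear inequalities: a known `a ≤ b` is transported once the ring solver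
-- confirms that both gaps agree.
≤-shift : ∀ {a b p q} → a ℚ.≤ b → q ℚ.- p ≡ b ℚ.- a → p ℚ.≤ q
≤-shift {a} {b} {p} {q} a≤b eq = begin
  p                          ≡⟨ solve 2 (λ p a → p := p :+ (a :- a)) refl p a ⟩
  p ℚ.+ (a ℚ.- a)            ≤⟨ ℚₚ.+-monoʳ-≤ p (ℚₚ.+-monoˡ-≤ (ℚ.- a) a≤b) ⟩
  p ℚ.+ (b ℚ.- a)            ≡⟨ cong (p ℚ.+_) (sym eq) ⟩
  p ℚ.+ (q ℚ.- p)            ≡⟨ p+[q-p]≡q p q ⟩
  q                          ∎
  where open ℚₚ.≤-Reasoning

<-shift : ∀ {a b p q} → a ℚ.< b → q ℚ.- p ≡ b ℚ.- a → p ℚ.< q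
<-shift {a} {b} {p} {q} a<b eq = begin-strict
  p                          ≡⟨ solve 2 (λ p a → p := p :+ (a :- a)) refl p a ⟩
  p ℚ.+ (a ℚ.- a)            <⟨ ℚₚ.+-monoʳ-< p (ℚₚ.+-monoˡ-< (ℚ.- a) a<b) ⟩
  p ℚ.+ (b ℚ.- a)            ≡⟨ cong (p ℚ.+_) (sym eq) ⟩
  p ℚ.+ (q ℚ.- p)            ≡⟨ p+[q-p]≡q p q ⟩
  q                          ∎
  where open ℚₚ.≤-Reasoning

p≤q⇒0≤q-p : ∀ {p q} → p ℚ.≤ q → 0ℚ ℚ.≤ q ℚ.- p
p≤q⇒0≤q-p {p} {q} p≤q = ≤-shift p≤q (solve 2 (λ p q → q :- p :- con 0ℚ := q :- p) refl p q)

p≤q⇒p-q≤0 : ∀ {p q} → p ℚ.≤ q → p ℚ.- q ℚ.≤ 0ℚ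
p≤q⇒p-q≤0 {p} {q} p≤q = ≤-shift p≤q (solve 2 (λ p q → con 0ℚ :- (p :- q) := q :- p) refl p q)

p≤∣p∣ : ∀ p → p ℚ.≤ ℚ.∣ p ∣
p≤∣p∣ p with ℚₚ.≤-total 0ℚ p
... | inj₁ 0≤p = ℚₚ.≤-reflexive (sym (ℚₚ.0≤p⇒∣p∣≡p 0≤p))
... | inj₂ p≤0 = ℚₚ.≤-trans p≤0 (ℚₚ.0≤∣p∣ p)

∣-∣≤ : ∀ {p r} → p ℚ.≤ r → ℚ.- p ℚ.≤ r → ℚ.∣ p ∣ ℚ.≤ r
∣-∣≤ {p} p≤r -p≤r with ℚₚ.∣p∣≡p∨∣p∣≡-p p
... | inj₁ eq = subst (ℚ._≤ _) (sym eq) p≤r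
... | inj₂ eq = subst (ℚ._≤ _) (sym eq) -p≤r

-p≤∣p∣ : ∀ p → ℚ.- p ℚ.≤ ℚ.∣ p ∣
-p≤∣p∣ p = subst (ℚ.- p ℚ.≤_) (ℚₚ.∣-p∣≡∣p∣ p) (p≤∣p∣ (ℚ.- p))

∣p-q∣≡∣q-p∣ : ∀ p q → ℚ.∣ p ℚ.- q ∣ ≡ ℚ.∣ q ℚ.- p ∣
∣p-q∣≡∣q-p∣ p q = trans (sym (ℚₚ.∣-p∣≡∣p∣ (p ℚ.- q)))
  (cong ℚ.∣_∣ (solve 2 (λ p q → :- (p :- q) := q :- p) refl p q))

close-≤ : ∀ {t c ε} → t ℚ.≤ c ℚ.+ ε → c ℚ.≤ t ℚ.+ ε → ℚ.∣ t ℚ.- c ∣ ℚ.≤ ε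
close-≤ {t} {c} {ε} t≤ c≤ = ∣-∣≤
  (≤-shift t≤ (solve 3 (λ t c e → e :- (t :- c) := c :+ e :- t) refl t c ε))
  (≤-shift c≤ (solve 3 (λ t c e → e :- (:- (t :- c)) := t :+ e :- c) refl t c ε))

half-positive : ∀ {p} → 0ℚ ℚ.< p → 0ℚ ℚ.< ½ ℚ.* p
half-positive {p} 0<p = subst (ℚ._< ½ ℚ.* p) (ℚₚ.*-zeroʳ ½) (ℚₚ.*-monoʳ-<-pos ½ 0<p)

halves : ∀ p → ½ ℚ.* p ℚ.+ ½ ℚ.* p ≡ p
halves = solve 1 (λ p → con ½ :* p :+ con ½ :* p := p) refl

≤-closed : ∀ {p q} → (∀ ε → 0ℚ ℚ.< ε → p ℚ.≤ q ℚ.+ ε) → p ℚ.≤ q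
≤-closed {p} {q} close = ℚₚ.≮⇒≥ λ q<p → ℚₚ.<-irrefl refl (ℚₚ.<-≤-trans
  (half-positive (0<gap q<p))
  (≤-shift (close (½ ℚ.* (p ℚ.- q)) (half-positive (0<gap q<p)))
    (solve 2 (λ p q → con 0ℚ :- con ½ :* (p :- q) := q :+ con ½ :* (p :- q) :- p) refl p q)))
  where
  0<gap : q ℚ.< p → 0ℚ ℚ.< p ℚ.- q
  0<gap q<p = <-shift q<p (solve 2 (λ p q → p :- q :- con 0ℚ := p :- q) refl p q)

p-q≡0⇒p≡q : ∀ {p q} → p ℚ.- q ≡ 0ℚ → p ≡ q
p-q≡0⇒p≡q {p} {q} eq = trans (solve 2 (λ p q → p := p :- q :+ q) refl p q) (trans (cong (ℚ._+ q) eq) (ℚₚ.+-identityˡ q))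

∣*∣-mono : ∀ {p q r s} → ℚ.∣ p ∣ ℚ.≤ r → ℚ.∣ q ∣ ℚ.≤ s → ℚ.∣ p ℚ.* q ∣ ℚ.≤ r ℚ.* s
∣*∣-mono {p} {q} {r} {s} p≤r q≤s = begin
  ℚ.∣ p ℚ.* q ∣          ≡⟨ ℚₚ.∣p*q∣≡∣p∣*∣q∣ p q ⟩
  ℚ.∣ p ∣ ℚ.* ℚ.∣ q ∣    ≤⟨ ℚₚ.*-monoʳ-≤-nonNeg ℚ.∣ q ∣ {{ℚₚ.∣-∣-nonNeg q}} p≤r ⟩
  r ℚ.* ℚ.∣ q ∣          ≤⟨ ℚₚ.*-monoˡ-≤-nonNeg r {{ℚ.nonNegative (ℚₚ.≤-trans (ℚₚ.0≤∣p∣ p) p≤r)}} q≤s ⟩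
  r ℚ.* s                ∎
  where open ℚₚ.≤-Reasoning

-- The factor `σ` is a sign of `p`. It later serves as the slope of a potential, whence the bound by
-- 1.
signed-abs : ∀ p → ∃[ σ ] ℚ.∣ σ ∣ ℚ.≤ 1ℚ × p ℚ.* σ ≡ ℚ.∣ p ∣
signed-abs p with ℚₚ.∣p∣≡p∨∣p∣≡-p p
... | inj₁ eq = 1ℚ , ℚₚ.≤-refl , trans (ℚₚ.*-identityʳ p) (sym eq)
... | inj₂ eq = ℚ.- 1ℚ , ℚₚ.≤-refl ,
  trans (solve 1 (λ p → p :* (:- con 1ℚ) := :- p) refl p) (sym eq)

-- Finite sums of rationals

sum-zero : ∀ {n} {f : Fin n → ℚ} → (∀ i → f i ≡ 0ℚ) → sum f ≡ 0ℚ
sum-zero {n} f≡0 = trans (sum-cong-≗ f≡0) (sum-replicate-zero n)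

sum-mono-≤ : ∀ {n} {f g : Fin n → ℚ} → (∀ i → f i ℚ.≤ g i) → sum f ℚ.≤ sum g
sum-mono-≤ {zero}  f≤g = ℚₚ.≤-refl
sum-mono-≤ {suc n} f≤g = ℚₚ.+-mono-≤ (f≤g zero) (sum-mono-≤ (f≤g ∘ suc))

sum-mono-< : ∀ {n} {f g : Fin n → ℚ} i → (∀ j → f j ℚ.≤ g j) → f i ℚ.< g i → sum f ℚ.< sum g
sum-mono-< zero    f≤g fi<gi = ℚₚ.+-mono-<-≤ fi<gi (sum-mono-≤ (f≤g ∘ suc))
sum-mono-< (suc i) f≤g fi<gi = ℚₚ.+-mono-≤-< (f≤g zero) (sum-mono-< i (f≤g ∘ suc) fi<gi)

-- Linear dependence

-- Gaussian elimination of the first coordinate, by induction on the dimension.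
linear-dependence : ∀ k (w : Fin (suc k) → Fin k → ℚ) →
  Σ[ c ∈ (Fin (suc k) → ℚ) ] (Σ[ i ∈ Fin (suc k) ] c i ≢ 0ℚ) × (∀ j → sum (λ i → c i ℚ.* w i j) ≡ 0ℚ)
linear-dependence zero w = (λ _ → 1ℚ) , (zero , λ ()) , λ ()
linear-dependence (suc k) w with any? (λ i → ¬? (w i zero ℚ.≟ 0ℚ))
-- The first coordinate vanishes throughout, so it is dropped together with the first vector, whose
-- coefficient is 0.
... | no column≡0 = c , (suc (proj₁ nonzero) , proj₂ nonzero) , combination
  where
  IH = linear-dependence k (λ i j → w (suc i) (suc j))
  nonzero = proj₁ (proj₂ IH)
  c : Fin (suc (suc k)) → ℚ
  c zero    = 0ℚ
  c (suc i) = proj₁ IH i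
  combination : ∀ j → sum (λ i → c i ℚ.* w i j) ≡ 0ℚ
  combination (suc j) = cong₂ ℚ._+_ (ℚₚ.*-zeroˡ (w zero (suc j))) (proj₂ (proj₂ IH) j)
  combination zero    = sum-zero λ i → trans
    (cong (c i ℚ.*_) (decidable-stable (w i zero ℚ.≟ 0ℚ) (λ w≢0 → column≡0 (i , w≢0))))
    (ℚₚ.*-zeroʳ (c i))
-- The vector `w i` clears the first coordinate of the other `suc k` vectors, which leaves them with
-- `k` coordinates.
... | yes (i , pivot≢0) = c , (punchIn i a , c≢0) , combination
  where
  instance _ = ℚ.≢-nonZero pivot≢0
  pivot = w i zero
  ratio : Fin (suc k) → ℚ
  ratio b = w (punchIn i b) zero ℚ.* ℚ.1/ pivot
  reduced : Fin (suc k) → Fin (suc k) → ℚ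
  reduced b j = w (punchIn i b) j ℚ.- ratio b ℚ.* w i j
  IH = linear-dependence k (λ b → reduced b ∘ suc)
  μ = proj₁ IH
  a = proj₁ (proj₁ (proj₂ IH))
  -- The coefficient of the pivot vector collects the multiples of it subtracted in `reduced`, so
  -- that `c` combines `w` to what `μ` makes of `reduced`.
  cᵢ = sum (λ b → ℚ.- (μ b ℚ.* ratio b))
  c = insertAt μ i cᵢ
  c≢0 : c (punchIn i a) ≢ 0ℚ
  c≢0 = proj₂ (proj₁ (proj₂ IH)) ∘ trans (sym (insertAt-punchIn μ i cᵢ a))
  reduced-vanishes : ∀ j → sum (λ b → μ b ℚ.* reduced b j) ≡ 0ℚ
  reduced-vanishes (suc j) = proj₂ (proj₂ IH) j
  reduced-vanishes zero    = sum-zero λ b → begin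
    μ b ℚ.* (w (punchIn i b) zero ℚ.- w (punchIn i b) zero ℚ.* ℚ.1/ pivot ℚ.* pivot)
      ≡⟨ solve 4 (λ m u q p → m :* (u :- u :* q :* p) := m :* (u :- u :* (q :* p))) refl (μ b) (w (punchIn i b) zero) (ℚ.1/ pivot) pivot ⟩
    μ b ℚ.* (w (punchIn i b) zero ℚ.- w (punchIn i b) zero ℚ.* (ℚ.1/ pivot ℚ.* pivot))
      ≡⟨ cong (λ q → μ b ℚ.* (w (punchIn i b) zero ℚ.- w (punchIn i b) zero ℚ.* q)) (ℚₚ.*-inverseˡ pivot) ⟩
    μ b ℚ.* (w (punchIn i b) zero ℚ.- w (punchIn i b) zero ℚ.* 1ℚ)
      ≡⟨ solve 2 (λ m u → m :* (u :- u :* con 1ℚ) := con 0ℚ) refl (μ b) (w (punchIn i b) zero) ⟩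
    0ℚ ∎
    where open ≡-Reasoning
  combination : ∀ j → sum (λ i → c i ℚ.* w i j) ≡ 0ℚ
  combination j = begin
    sum (λ b → c b ℚ.* w b j)
      ≡⟨ sum-remove {i = i} (λ b → c b ℚ.* w b j) ⟩
    c i ℚ.* w i j ℚ.+ sum (λ b → c (punchIn i b) ℚ.* w (punchIn i b) j)
      ≡⟨ cong₂ ℚ._+_ (cong (ℚ._* w i j) (insertAt-lookup μ i cᵢ))
                     (sum-cong-≗ λ b → cong (ℚ._* w (punchIn i b) j) (insertAt-punchIn μ i cᵢ b)) ⟩
    cᵢ ℚ.* w i j ℚ.+ sum (λ b → μ b ℚ.* w (punchIn i b) j)
      ≡⟨ cong (ℚ._+ sum (λ b → μ b ℚ.* w (punchIn i b) j)) (*-distribʳ-sum (w i j) (λ b → ℚ.- (μ b ℚ.* ratio b))) ⟩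
    sum (λ b → ℚ.- (μ b ℚ.* ratio b) ℚ.* w i j) ℚ.+ sum (λ b → μ b ℚ.* w (punchIn i b) j)
      ≡⟨ sym (∑-distrib-+ (λ b → ℚ.- (μ b ℚ.* ratio b) ℚ.* w i j) (λ b → μ b ℚ.* w (punchIn i b) j)) ⟩
    sum (λ b → ℚ.- (μ b ℚ.* ratio b) ℚ.* w i j ℚ.+ μ b ℚ.* w (punchIn i b) j)
      ≡⟨ sum-cong-≗ (λ b → solve 4 (λ m r u v → :- (m :* r) :* u :+ m :* v := m :* (v :- r :* u)) refl (μ b) (ratio b) (w i j) (w (punchIn i b) j)) ⟩
    sum (λ b → μ b ℚ.* reduced b j)
      ≡⟨ reduced-vanishes j ⟩
    0ℚ ∎
    where open ≡-Reasoning

-- Subtracting from A the amounts B, whose c-combination vanishes, leaves Σ c A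
-- unchanged; this is impossible if it brings every entry below H.
no-short-family : ∀ {n} {H} (c A B : Fin n → ℚ) i → c i ≢ 0ℚ →
  (∀ i → c i ℚ.* A i ≡ ℚ.∣ c i ∣ ℚ.* H) → sum (λ i → c i ℚ.* B i) ≡ 0ℚ →
  ¬ (∀ i → ℚ.∣ A i ℚ.- B i ∣ ℚ.< H)
no-short-family {H = H} c A B i cᵢ≢0 aligned vanishes short = ℚₚ.<-irrefl refl (begin-strict
  sum (λ i → c i ℚ.* A i)
    ≡⟨ solve 1 (λ x → x := x :- con 0ℚ) refl _ ⟩
  sum (λ i → c i ℚ.* A i) ℚ.- 0ℚ
    ≡⟨ cong (λ x → sum (λ i → c i ℚ.* A i) ℚ.- x) (sym vanishes) ⟩
  sum (λ i → c i ℚ.* A i) ℚ.- sum (λ i → c i ℚ.* B i)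
    ≡⟨ cong (sum (λ i → c i ℚ.* A i) ℚ.+_) (solve 1 (λ x → :- x := con (ℚ.- 1ℚ) :* x) refl (sum (λ i → c i ℚ.* B i))) ⟩
  sum (λ i → c i ℚ.* A i) ℚ.+ (ℚ.- 1ℚ) ℚ.* sum (λ i → c i ℚ.* B i)
    ≡⟨ cong (sum (λ i → c i ℚ.* A i) ℚ.+_) (*-distribˡ-sum (ℚ.- 1ℚ) (λ i → c i ℚ.* B i)) ⟩
  sum (λ i → c i ℚ.* A i) ℚ.+ sum (λ i → (ℚ.- 1ℚ) ℚ.* (c i ℚ.* B i))
    ≡⟨ sym (∑-distrib-+ (λ i → c i ℚ.* A i) _) ⟩
  sum (λ i → c i ℚ.* A i ℚ.+ (ℚ.- 1ℚ) ℚ.* (c i ℚ.* B i))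
    ≡⟨ sum-cong-≗ (λ i → solve 3 (λ c a b → c :* a :+ con (ℚ.- 1ℚ) :* (c :* b) := c :* (a :- b)) refl (c i) (A i) (B i)) ⟩
  sum (λ i → c i ℚ.* (A i ℚ.- B i))
    -- All terms satisfy the weak inequality; strictness comes from the index `i` with nonzero
    -- coefficient.
    <⟨ sum-mono-< i (λ j → ℚₚ.≤-trans (term j) (ℚₚ.*-monoˡ-≤-nonNeg ℚ.∣ c j ∣ {{ℚₚ.∣-∣-nonNeg (c j)}} (ℚₚ.<⇒≤ (short j))))
         (ℚₚ.≤-<-trans (term i) (ℚₚ.*-monoʳ-<-pos ℚ.∣ c i ∣ {{ℚ.positive 0<∣cᵢ∣}} (short i))) ⟩
  sum (λ i → ℚ.∣ c i ∣ ℚ.* H)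
    ≡⟨ sum-cong-≗ (sym ∘ aligned) ⟩
  sum (λ i → c i ℚ.* A i) ∎)
  where
  open ℚₚ.≤-Reasoning
  term : ∀ j → c j ℚ.* (A j ℚ.- B j) ℚ.≤ ℚ.∣ c j ∣ ℚ.* ℚ.∣ A j ℚ.- B j ∣
  term j = ℚₚ.≤-trans (p≤∣p∣ _) (ℚₚ.≤-reflexive (ℚₚ.∣p*q∣≡∣p∣*∣q∣ (c j) (A j ℚ.- B j)))
  0<∣cᵢ∣ : 0ℚ ℚ.< ℚ.∣ c i ∣
  0<∣cᵢ∣ with ℚₚ.<-cmp 0ℚ ℚ.∣ c i ∣
  ... | tri< 0< _ _ = 0<
  ... | tri≈ _ 0≡ _ = contradiction (ℚₚ.∣p∣≡0⇒p≡0 (c i) (sym 0≡)) cᵢ≢0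
  ... | tri> _ _ <0 = contradiction (ℚₚ.≤-<-trans (ℚₚ.0≤∣p∣ (c i)) <0) (ℚₚ.<-irrefl refl)

-- Exchanging the sums turns a dependence among usage vectors into the cancellation of the total
-- height gained at wormholes, whatever the jumps `φ` are.
∑-bilinear : ∀ {m n} (c : Fin m → ℚ) (w : Fin m → Fin n → ℚ) (φ : Fin n → ℚ) →
  (∀ j → sum (λ i → c i ℚ.* w i j) ≡ 0ℚ) →
  sum (λ i → c i ℚ.* sum (λ j → w i j ℚ.* φ j)) ≡ 0ℚ
∑-bilinear c w φ vanishes = begin
  sum (λ i → c i ℚ.* sum (λ j → w i j ℚ.* φ j))
    ≡⟨ sum-cong-≗ (λ i → *-distribˡ-sum (c i) (λ j → w i j ℚ.* φ j)) ⟩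
  sum (λ i → sum (λ j → c i ℚ.* (w i j ℚ.* φ j)))
    ≡⟨ ∑-comm (λ i j → c i ℚ.* (w i j ℚ.* φ j)) ⟩
  sum (λ j → sum (λ i → c i ℚ.* (w i j ℚ.* φ j)))
    ≡⟨ sum-zero (λ j → begin
       sum (λ i → c i ℚ.* (w i j ℚ.* φ j))  ≡⟨ sum-cong-≗ (λ i → sym (ℚₚ.*-assoc (c i) (w i j) (φ j))) ⟩
       sum (λ i → c i ℚ.* w i j ℚ.* φ j)    ≡⟨ sym (*-distribʳ-sum (φ j) (λ i → c i ℚ.* w i j)) ⟩
       sum (λ i → c i ℚ.* w i j) ℚ.* φ j    ≡⟨ cong (ℚ._* φ j) (vanishes j) ⟩
       0ℚ ℚ.* φ j                           ≡⟨ ℚₚ.*-zeroˡ (φ j) ⟩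
       0ℚ                                   ∎) ⟩
  0ℚ ∎
  where open ≡-Reasoning

-- Eventual inequalities between sequences

infix 4 _≲_
-- The order of the reals on bare sequences: `x ≤ y` unfolds to `seq x ≲ seq y`. Quantities such as
-- the gain along a path can thus be compared without a proof that they are Cauchy.
_≲_ : (ℕ → ℚ) → (ℕ → ℚ) → Set
a ≲ b = ∀ ε → 0ℚ ℚ.< ε → ∃[ N ] (∀ m → N ℕ.≤ m → a m ℚ.≤ b m ℚ.+ ε)

pointwise : ∀ {a b} → (∀ m → a m ℚ.≤ b m) → a ≲ b
pointwise {b = b} a≤b ε 0<ε = 0 , λ m _ → begin
  _           ≤⟨ a≤b m ⟩
  b m         ≡⟨ sym (ℚₚ.+-identityʳ (b m)) ⟩
  b m ℚ.+ 0ℚ  ≤⟨ ℚₚ.+-monoʳ-≤ (b m) (ℚₚ.<⇒≤ 0<ε) ⟩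
  b m ℚ.+ ε   ∎
  where open ℚₚ.≤-Reasoning

≲-+ : ∀ {a b c d} → a ≲ b → c ≲ d → (λ m → a m ℚ.+ c m) ≲ (λ m → b m ℚ.+ d m)
≲-+ {a} {b} {c} {d} a≲b c≲d ε 0<ε =
  let (M , M-ok) = a≲b (½ ℚ.* ε) (half-positive 0<ε)
      (N , N-ok) = c≲d (½ ℚ.* ε) (half-positive 0<ε)
  in M ℕ.⊔ N , λ m m≥ → begin
    a m ℚ.+ c m
      ≤⟨ ℚₚ.+-mono-≤ (M-ok m (ℕₚ.m⊔n≤o⇒m≤o M N m≥)) (N-ok m (ℕₚ.m⊔n≤o⇒n≤o M N m≥)) ⟩
    (b m ℚ.+ ½ ℚ.* ε) ℚ.+ (d m ℚ.+ ½ ℚ.* ε)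
      ≡⟨ solve 3 (λ b d e → (b :+ con ½ :* e) :+ (d :+ con ½ :* e) := b :+ d :+ e) refl (b m) (d m) ε ⟩
    b m ℚ.+ d m ℚ.+ ε ∎
  where open ℚₚ.≤-Reasoning

-- Adding the two hypotheses and cancelling `b` reuses the splitting of `ε` in `≲-+`.
≲-trans : ∀ {a b c} → a ≲ b → b ≲ c → a ≲ c
≲-trans {a} {b} {c} a≲b b≲c ε 0<ε =
  let (N , N-ok) = ≲-+ {a} {b} {b} {c} a≲b b≲c ε 0<ε
  in N , λ m m≥ → ≤-shift (N-ok m m≥)
       (solve 4 (λ a b c e → c :+ e :- a := b :+ c :+ e :- (a :+ b)) refl (a m) (b m) (c m) ε)

-- Finitely many eventual bounds share an index, at which an argument about reals becomes one about
-- rationals.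
eventually-all : ∀ {k} {P : Fin k → ℕ → Set} → (∀ i → ∃[ N ] (∀ m → N ℕ.≤ m → P i m)) →
  ∃[ m ] (∀ i → P i m)
eventually-all {k} {P} eventually = let (N , N-ok) = go eventually in N , λ i → N-ok N ℕₚ.≤-refl i
  where
  go : ∀ {k} {P : Fin k → ℕ → Set} → (∀ i → ∃[ N ] (∀ m → N ℕ.≤ m → P i m)) →
    ∃[ N ] (∀ m → N ℕ.≤ m → ∀ i → P i m)
  go {zero}  ev = 0 , λ _ _ ()
  go {suc k} ev =
    let (M , M-ok) = ev zero
        (N , N-ok) = go (ev ∘ suc)
    in M ℕ.⊔ N , λ { m m≥ zero    → M-ok m (ℕₚ.m⊔n≤o⇒m≤o M N m≥)
                   ; m m≥ (suc i) → N-ok m (ℕₚ.m⊔n≤o⇒n≤o M N m≥) i }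

-- One rational comparison suffices, at an index `N` after which `q` moves by at most `ε/2`. Either
-- `c ≤ seq q N + ε/2`, which persists up to another `ε/2`, or the gap witnesses `q < fromℚ c`.
≮⇒≥ : ∀ {c} q → ¬ (q < fromℚ c) → fromℚ c ≤ q
≮⇒≥ {c} q q≮c ε 0<ε with cauchy q (½ ℚ.* ε) (half-positive 0<ε)
... | N , N-ok with c ℚ.≤? seq q N ℚ.+ ½ ℚ.* ε
...   | yes c≤ = N , λ m m≥ → ≤-shift
          (ℚₚ.+-mono-≤ c≤ (ℚₚ.≤-trans (p≤∣p∣ _) (N-ok N m ℕₚ.≤-refl m≥)))
          (solve 4 (λ c n m e → m :+ e :- c := n :+ con ½ :* e :+ con ½ :* e :- (c :+ (n :- m))) refl c (seq q N) (seq q m) ε)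
...   | no c≰ = contradiction
          ( c ℚ.- (seq q N ℚ.+ ½ ℚ.* ε)
          , <-shift (ℚₚ.≰⇒> c≰) (solve 2 (λ c x → c :- x :- con 0ℚ := c :- x) refl c (seq q N ℚ.+ ½ ℚ.* ε))
          , N , λ m m≥ → ≤-shift (ℚₚ.≤-trans (p≤∣p∣ _) (N-ok m N m≥ ℕₚ.≤-refl))
              (solve 4 (λ c n m h → c :- (m :+ (c :- (n :+ h))) := h :- (m :- n)) refl c (seq q N) (seq q m) (½ ℚ.* ε)) )
          q≮c

<⇒≱ : ∀ {x y} → x < y → ¬ (y ≤ x)
<⇒≱ {x} {y} (ε , 0<ε , M , M-ok) y≤x =
  let (N , N-ok) = y≤x (½ ℚ.* ε) (half-positive 0<ε)
      m = M ℕ.⊔ N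
  in ℚₚ.<-irrefl refl (ℚₚ.<-≤-trans (half-positive 0<ε) (≤-shift
       (ℚₚ.+-mono-≤ (M-ok m (ℕₚ.m≤m⊔n M N)) (N-ok m (ℕₚ.m≤n⊔m M N)))
       (solve 3 (λ x y e → con 0ℚ :- con ½ :* e := y :+ (x :+ con ½ :* e) :- (x :+ e :+ y)) refl (seq x m) (seq y m) ε)))


-- Piecewise linear functions

-- The continuous function on [0, ∞) vanishing at 0 whose consecutive pieces
-- have lengths ℓ i and slopes σ i; it is constant after the last piece.
zigzag : ∀ {n} (ℓ σ : Fin n → ℚ) → ℚ → ℚ
zigzag {zero}  ℓ σ t = 0ℚ
zigzag {suc n} ℓ σ t =
  σ zero ℚ.* (t ℚ.⊓ ℓ zero) ℚ.+ zigzag (ℓ ∘ suc) (σ ∘ suc) ((t ℚ.- ℓ zero) ℚ.⊔ 0ℚ)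

p⊓q+[p-q]⊔0≡p : ∀ p q → (p ℚ.⊓ q) ℚ.+ ((p ℚ.- q) ℚ.⊔ 0ℚ) ≡ p
p⊓q+[p-q]⊔0≡p p q with ℚₚ.≤-total p q
... | inj₁ p≤q = trans
      (cong₂ ℚ._+_ (ℚₚ.p≤q⇒p⊓q≡p p≤q)
        (ℚₚ.p≤q⇒p⊔q≡q (p≤q⇒p-q≤0 p≤q)))
      (ℚₚ.+-identityʳ p)
... | inj₂ q≤p = trans
      (cong₂ ℚ._+_ (ℚₚ.p≥q⇒p⊓q≡q q≤p)
        (ℚₚ.p≥q⇒p⊔q≡p (p≤q⇒0≤q-p q≤p)))
      (p+[q-p]≡q q p)

-- Each piece splits the increment from `t` to `u` into a part inside it and a part beyond it. For
-- `t ≤ u` both are nonnegative, and they add up to exactly `u - t`.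
zigzag-variation : ∀ {n} (ℓ σ : Fin n → ℚ) → (∀ i → ℚ.∣ σ i ∣ ℚ.≤ 1ℚ) →
  ∀ {t u} → t ℚ.≤ u → ℚ.∣ zigzag ℓ σ u ℚ.- zigzag ℓ σ t ∣ ℚ.≤ u ℚ.- t
zigzag-variation {zero}  ℓ σ σ≤1 {t} {u} t≤u =
  ≤-shift t≤u (solve 2 (λ t u → u :- t :- con 0ℚ := u :- t) refl t u)
zigzag-variation {suc n} ℓ σ σ≤1 {t} {u} t≤u = begin
  ℚ.∣ (σ₀ ℚ.* u⊓ ℚ.+ Zu) ℚ.- (σ₀ ℚ.* t⊓ ℚ.+ Zt) ∣
    ≡⟨ cong ℚ.∣_∣ (solve 5 (λ s a b c d → (s :* a :+ b) :- (s :* c :+ d) := s :* (a :- c) :+ (b :- d)) refl σ₀ u⊓ Zu t⊓ Zt) ⟩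
  ℚ.∣ σ₀ ℚ.* (u⊓ ℚ.- t⊓) ℚ.+ (Zu ℚ.- Zt) ∣
    ≤⟨ ℚₚ.∣p+q∣≤∣p∣+∣q∣ (σ₀ ℚ.* (u⊓ ℚ.- t⊓)) (Zu ℚ.- Zt) ⟩
  ℚ.∣ σ₀ ℚ.* (u⊓ ℚ.- t⊓) ∣ ℚ.+ ℚ.∣ Zu ℚ.- Zt ∣
    ≤⟨ ℚₚ.+-mono-≤ (∣*∣-mono (σ≤1 zero) (ℚₚ.≤-reflexive (ℚₚ.0≤p⇒∣p∣≡p (p≤q⇒0≤q-p t⊓≤u⊓))))
                   (zigzag-variation (ℓ ∘ suc) (σ ∘ suc) (σ≤1 ∘ suc) t⊔≤u⊔) ⟩
  1ℚ ℚ.* (u⊓ ℚ.- t⊓) ℚ.+ (u⊔ ℚ.- t⊔)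
    ≡⟨ solve 4 (λ a b c d → con 1ℚ :* (a :- b) :+ (c :- d) := (a :+ c) :- (b :+ d)) refl u⊓ t⊓ u⊔ t⊔ ⟩
  (u⊓ ℚ.+ u⊔) ℚ.- (t⊓ ℚ.+ t⊔)
    ≡⟨ cong₂ ℚ._-_ (p⊓q+[p-q]⊔0≡p u (ℓ zero)) (p⊓q+[p-q]⊔0≡p t (ℓ zero)) ⟩
  u ℚ.- t ∎
  where
  open ℚₚ.≤-Reasoning
  σ₀ = σ zero
  t⊓ = t ℚ.⊓ ℓ zero
  u⊓ = u ℚ.⊓ ℓ zero
  t⊔ = (t ℚ.- ℓ zero) ℚ.⊔ 0ℚ
  u⊔ = (u ℚ.- ℓ zero) ℚ.⊔ 0ℚ
  Zt = zigzag (ℓ ∘ suc) (σ ∘ suc) t⊔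
  Zu = zigzag (ℓ ∘ suc) (σ ∘ suc) u⊔
  t⊓≤u⊓ : t⊓ ℚ.≤ u⊓
  t⊓≤u⊓ = ℚₚ.⊓-monoˡ-≤ (ℓ zero) t≤u
  t⊔≤u⊔ : t⊔ ℚ.≤ u⊔
  t⊔≤u⊔ = ℚₚ.⊔-monoˡ-≤ 0ℚ (ℚₚ.+-monoˡ-≤ (ℚ.- ℓ zero) t≤u)

zigzag-lipschitz : ∀ {n} (ℓ σ : Fin n → ℚ) → (∀ i → ℚ.∣ σ i ∣ ℚ.≤ 1ℚ) →
  ∀ t u → ℚ.∣ zigzag ℓ σ t ℚ.- zigzag ℓ σ u ∣ ℚ.≤ ℚ.∣ t ℚ.- u ∣
zigzag-lipschitz ℓ σ σ≤1 t u with ℚₚ.≤-total t u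
... | inj₁ t≤u = begin
  ℚ.∣ zigzag ℓ σ t ℚ.- zigzag ℓ σ u ∣  ≡⟨ ∣p-q∣≡∣q-p∣ (zigzag ℓ σ t) (zigzag ℓ σ u) ⟩
  ℚ.∣ zigzag ℓ σ u ℚ.- zigzag ℓ σ t ∣  ≤⟨ zigzag-variation ℓ σ σ≤1 t≤u ⟩
  u ℚ.- t                              ≤⟨ p≤∣p∣ (u ℚ.- t) ⟩
  ℚ.∣ u ℚ.- t ∣                        ≡⟨ ∣p-q∣≡∣q-p∣ u t ⟩
  ℚ.∣ t ℚ.- u ∣                        ∎
  where open ℚₚ.≤-Reasoning
... | inj₂ u≤t = ℚₚ.≤-trans (zigzag-variation ℓ σ σ≤1 u≤t) (p≤∣p∣ (t ℚ.- u))

zigzag-zero : ∀ {n} (ℓ σ : Fin n → ℚ) → (∀ i → 0ℚ ℚ.≤ ℓ i) → zigzag ℓ σ 0ℚ ≡ 0ℚ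
zigzag-zero {zero}  ℓ σ 0≤ℓ = refl
zigzag-zero {suc n} ℓ σ 0≤ℓ = cong₂ ℚ._+_
  (trans (cong (σ zero ℚ.*_) (ℚₚ.p≤q⇒p⊓q≡p (0≤ℓ zero))) (ℚₚ.*-zeroʳ (σ zero)))
  (trans (cong (zigzag (ℓ ∘ suc) (σ ∘ suc))
           (ℚₚ.p≤q⇒p⊔q≡q (p≤q⇒p-q≤0 (0≤ℓ zero))))
         (zigzag-zero (ℓ ∘ suc) (σ ∘ suc) (0≤ℓ ∘ suc)))

zigzag-past : ∀ {n} (ℓ σ : Fin (suc n) → ℚ) {t} → 0ℚ ℚ.≤ t →
  zigzag ℓ σ (ℓ zero ℚ.+ t) ≡ σ zero ℚ.* ℓ zero ℚ.+ zigzag (ℓ ∘ suc) (σ ∘ suc) t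
zigzag-past ℓ σ {t} 0≤t = cong₂ ℚ._+_
  (cong (σ zero ℚ.*_) (ℚₚ.p≥q⇒p⊓q≡q {ℓ zero ℚ.+ t} (≤-shift 0≤t (solve 2 (λ l t → l :+ t :- l := t :- con 0ℚ) refl (ℓ zero) t))))
  (cong (zigzag (ℓ ∘ suc) (σ ∘ suc)) (trans
    (cong (ℚ._⊔ 0ℚ) (solve 2 (λ l t → l :+ t :- l := t) refl (ℓ zero) t))
    (ℚₚ.p≥q⇒p⊔q≡p 0≤t)))

zigzag-initial : ∀ {n} (ℓ σ : Fin (suc n) → ℚ) → (∀ i → 0ℚ ℚ.≤ ℓ i) →
  ∀ {t} → t ℚ.≤ ℓ zero → zigzag ℓ σ t ≡ σ zero ℚ.* t
zigzag-initial ℓ σ 0≤ℓ {t} t≤ℓ = begin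
  σ zero ℚ.* (t ℚ.⊓ ℓ zero) ℚ.+ zigzag (ℓ ∘ suc) (σ ∘ suc) ((t ℚ.- ℓ zero) ℚ.⊔ 0ℚ)
    ≡⟨ cong₂ (λ a b → σ zero ℚ.* a ℚ.+ zigzag (ℓ ∘ suc) (σ ∘ suc) b)
         (ℚₚ.p≤q⇒p⊓q≡p t≤ℓ) (ℚₚ.p≤q⇒p⊔q≡q (p≤q⇒p-q≤0 t≤ℓ)) ⟩
  σ zero ℚ.* t ℚ.+ zigzag (ℓ ∘ suc) (σ ∘ suc) 0ℚ
    ≡⟨ cong (σ zero ℚ.* t ℚ.+_) (zigzag-zero (ℓ ∘ suc) (σ ∘ suc) (0≤ℓ ∘ suc)) ⟩
  σ zero ℚ.* t ℚ.+ 0ℚ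
    ≡⟨ ℚₚ.+-identityʳ _ ⟩
  σ zero ℚ.* t ∎
  where open ≡-Reasoning

-- The breakpoints of `zigzag`: piece `j` begins at `onset ℓ j`.
onset : ∀ {n} → (Fin n → ℚ) → Fin n → ℚ
onset ℓ zero    = 0ℚ
onset ℓ (suc j) = ℓ zero ℚ.+ onset (ℓ ∘ suc) j

0≤onset : ∀ {n} (ℓ : Fin n → ℚ) → (∀ i → 0ℚ ℚ.≤ ℓ i) → ∀ j → 0ℚ ℚ.≤ onset ℓ j
0≤onset ℓ 0≤ℓ zero    = ℚₚ.≤-refl
0≤onset ℓ 0≤ℓ (suc j) = ℚₚ.+-mono-≤ (0≤ℓ zero) (0≤onset (ℓ ∘ suc) (0≤ℓ ∘ suc) j)

onset+ℓ≤sum : ∀ {n} (ℓ : Fin n → ℚ) → (∀ i → 0ℚ ℚ.≤ ℓ i) → ∀ j → onset ℓ j ℚ.+ ℓ j ℚ.≤ sum ℓ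
onset+ℓ≤sum {suc n} ℓ 0≤ℓ zero = begin
  0ℚ ℚ.+ ℓ zero                 ≡⟨ ℚₚ.+-comm 0ℚ (ℓ zero) ⟩
  ℓ zero ℚ.+ 0ℚ                 ≡⟨ cong (ℓ zero ℚ.+_) (sym (sum-replicate-zero n)) ⟩
  ℓ zero ℚ.+ sum {n} (λ _ → 0ℚ) ≤⟨ ℚₚ.+-monoʳ-≤ (ℓ zero) (sum-mono-≤ (0≤ℓ ∘ suc)) ⟩
  ℓ zero ℚ.+ sum (ℓ ∘ suc)      ∎
  where open ℚₚ.≤-Reasoning
onset+ℓ≤sum ℓ 0≤ℓ (suc j) = begin
  (ℓ zero ℚ.+ onset (ℓ ∘ suc) j) ℚ.+ ℓ (suc j)  ≡⟨ ℚₚ.+-assoc (ℓ zero) _ _ ⟩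
  ℓ zero ℚ.+ (onset (ℓ ∘ suc) j ℚ.+ ℓ (suc j))  ≤⟨ ℚₚ.+-monoʳ-≤ (ℓ zero) (onset+ℓ≤sum (ℓ ∘ suc) (0≤ℓ ∘ suc) j) ⟩
  ℓ zero ℚ.+ sum (ℓ ∘ suc)                      ∎
  where open ℚₚ.≤-Reasoning

-- Peeling off the first piece shifts both ends by its length and both values by the same constant,
-- so the earlier slopes have no influence.
zigzag-rise : ∀ {n} (ℓ σ : Fin n → ℚ) → (∀ i → 0ℚ ℚ.≤ ℓ i) → ∀ j →
  zigzag ℓ σ (onset ℓ j ℚ.+ ℓ j) ℚ.- zigzag ℓ σ (onset ℓ j) ≡ σ j ℚ.* ℓ j
zigzag-rise ℓ σ 0≤ℓ zero = begin
  zigzag ℓ σ (0ℚ ℚ.+ ℓ zero) ℚ.- zigzag ℓ σ 0ℚ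
    ≡⟨ cong₂ (λ t z → zigzag ℓ σ t ℚ.- z) (ℚₚ.+-identityˡ (ℓ zero)) (zigzag-zero ℓ σ 0≤ℓ) ⟩
  zigzag ℓ σ (ℓ zero) ℚ.- 0ℚ
    ≡⟨ cong (ℚ._- 0ℚ) (zigzag-initial ℓ σ 0≤ℓ ℚₚ.≤-refl) ⟩
  σ zero ℚ.* ℓ zero ℚ.- 0ℚ
    ≡⟨ ℚₚ.+-identityʳ _ ⟩
  σ zero ℚ.* ℓ zero ∎
  where open ≡-Reasoning
zigzag-rise ℓ σ 0≤ℓ (suc j) = begin
  zigzag ℓ σ (ℓ zero ℚ.+ s ℚ.+ ℓ (suc j)) ℚ.- zigzag ℓ σ (ℓ zero ℚ.+ s)
    ≡⟨ cong₂ ℚ._-_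
         (trans (cong (zigzag ℓ σ) (ℚₚ.+-assoc (ℓ zero) s (ℓ (suc j))))
                (zigzag-past ℓ σ (ℚₚ.+-mono-≤ 0≤s (0≤ℓ (suc j)))))
         (zigzag-past ℓ σ 0≤s) ⟩
  (a ℚ.+ zigzag (ℓ ∘ suc) (σ ∘ suc) (s ℚ.+ ℓ (suc j))) ℚ.- (a ℚ.+ zigzag (ℓ ∘ suc) (σ ∘ suc) s)
    ≡⟨ solve 3 (λ a b c → (a :+ b) :- (a :+ c) := b :- c) refl a (zigzag (ℓ ∘ suc) (σ ∘ suc) (s ℚ.+ ℓ (suc j))) (zigzag (ℓ ∘ suc) (σ ∘ suc) s) ⟩
  zigzag (ℓ ∘ suc) (σ ∘ suc) (s ℚ.+ ℓ (suc j)) ℚ.- zigzag (ℓ ∘ suc) (σ ∘ suc) s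
    ≡⟨ zigzag-rise (ℓ ∘ suc) (σ ∘ suc) (0≤ℓ ∘ suc) j ⟩
  σ (suc j) ℚ.* ℓ (suc j) ∎
  where
  open ≡-Reasoning
  s = onset (ℓ ∘ suc) j
  a = σ zero ℚ.* ℓ zero
  0≤s = 0≤onset (ℓ ∘ suc) (0≤ℓ ∘ suc) j

onset-injective : ∀ {n H} → 0ℚ ℚ.< H → (i j : Fin n) →
  onset (λ _ → H) i ≡ onset (λ _ → H) j → i ≡ j
onset-injective 0<H zero    zero    eq = refl
onset-injective {H = H} 0<H zero (suc j) eq = contradiction
  (ℚₚ.+-mono-<-≤ 0<H (0≤onset (λ _ → H) (λ _ → ℚₚ.<⇒≤ 0<H) j)) (ℚₚ.<-irrefl eq)
onset-injective {H = H} 0<H (suc i) zero eq = contradiction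
  (ℚₚ.+-mono-<-≤ 0<H (0≤onset (λ _ → H) (λ _ → ℚₚ.<⇒≤ 0<H) i)) (ℚₚ.<-irrefl (sym eq))
onset-injective {H = H} 0<H (suc i) (suc j) eq =
  cong suc (onset-injective 0<H i j (+-cancelˡ H _ _ eq))

-- Standard basis vectors

unit : ∀ {k} → Fin k → Fin k → ℚ
unit zero    zero    = 1ℚ
unit zero    (suc j) = 0ℚ
unit (suc i) zero    = 0ℚ
unit (suc i) (suc j) = unit i j

unit-diagonal : ∀ {k} (i : Fin k) → unit i i ≡ 1ℚ
unit-diagonal zero    = refl
unit-diagonal (suc i) = unit-diagonal i

unit-off-diagonal : ∀ {k} {i j : Fin k} → i ≢ j → unit i j ≡ 0ℚ
unit-off-diagonal {i = zero}  {zero}  i≢j = contradiction refl i≢j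
unit-off-diagonal {i = zero}  {suc j} i≢j = refl
unit-off-diagonal {i = suc i} {zero}  i≢j = refl
unit-off-diagonal {i = suc i} {suc j} i≢j = unit-off-diagonal (i≢j ∘ cong suc)

∣unit∣≤1 : ∀ {k} (i j : Fin k) → ℚ.∣ unit i j ∣ ℚ.≤ 1ℚ
∣unit∣≤1 zero    zero    = ℚₚ.≤-refl
∣unit∣≤1 zero    (suc j) = ℚₚ.nonNegative⁻¹ 1ℚ
∣unit∣≤1 (suc i) zero    = ℚₚ.nonNegative⁻¹ 1ℚ
∣unit∣≤1 (suc i) (suc j) = ∣unit∣≤1 i j

sum-unit : ∀ {k} (i : Fin k) (φ : Fin k → ℚ) → sum (λ j → unit i j ℚ.* φ j) ≡ φ i
sum-unit zero φ = trans
  (cong₂ ℚ._+_ (ℚₚ.*-identityˡ (φ zero)) (sum-zero (λ j → ℚₚ.*-zeroˡ (φ (suc j)))))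
  (ℚₚ.+-identityʳ (φ zero))
sum-unit (suc i) φ = trans
  (cong₂ ℚ._+_ (ℚₚ.*-zeroˡ (φ zero)) (sum-unit i (φ ∘ suc)))
  (ℚₚ.+-identityˡ (φ (suc i)))

-- Potentials on the star

-- Heights are defined and Lipschitz on all of ℚ, because the approximations `seq t m` of a real in
-- [0, 1] may leave that interval. Accordingly `level` depends on the index `m` of the
-- approximation.
record Potential (s : ℕ) : Set where
  field
    height    : Fin s → ℚ → ℚ
    centred   : ∀ e → height e 0ℚ ≡ 0ℚ
    lipschitz : ∀ e t u → ℚ.∣ height e t ℚ.- height e u ∣ ℚ.≤ ℚ.∣ t ℚ.- u ∣

  level : ℕ → Point (star s) → ℚ
  level m (vertex zero)    = 0ℚ
  level m (vertex (suc e)) = height e 1ℚ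
  level m (on e t _ _)     = height e (seq t m)

open Potential

module _ {s k} {W : Wormholes (star s) k} where

  stepUsage : ∀ {x y r} → Step (star s) W x y r → Fin k → ℚ
  stepUsage (wormhole i) j = unit i j
  stepUsage (reverse st) j = ℚ.- stepUsage st j
  stepUsage _            j = 0ℚ

  -- How often the path traverses wormhole j forwards, less how often backwards.
  usage : ∀ {x y r} → Path (star s) W x y r → Fin k → ℚ
  usage []       j = 0ℚ
  usage (st ∷ p) j = stepUsage st j ℚ.+ usage p j

module _ {s k} (f : Potential s) (W : Wormholes (star s) k) where

  jump : ℕ → Fin k → ℚ
  jump m j = level f m (proj₂ (W j)) ℚ.- level f m (proj₁ (W j))

  -- The part of the height difference that is left for movement along edges, once each wormhole `j`
  -- has contributed its jump `v j` times. It is additive under concatenation and odd under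
  -- reversal.
  gain : ℕ → Point (star s) → Point (star s) → (Fin k → ℚ) → ℚ
  gain m x y v = (level f m y ℚ.- level f m x) ℚ.- sum (λ j → v j ℚ.* jump m j)

  gain-zero : ∀ m x y → gain m x y (λ _ → 0ℚ) ≡ level f m y ℚ.- level f m x
  gain-zero m x y = trans
    (cong (λ S → (level f m y ℚ.- level f m x) ℚ.- S) (sum-zero (ℚₚ.*-zeroˡ ∘ jump m)))
    (ℚₚ.+-identityʳ _)

  gain-+ : ∀ m x y z v v′ →
    gain m x z (λ j → v j ℚ.+ v′ j) ≡ gain m x y v ℚ.+ gain m y z v′
  gain-+ m x y z v v′ = begin
    (lz ℚ.- lx) ℚ.- sum (λ j → (v j ℚ.+ v′ j) ℚ.* jump m j)
      ≡⟨ cong (λ S → (lz ℚ.- lx) ℚ.- S) (trans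
           (sum-cong-≗ (λ j → ℚₚ.*-distribʳ-+ (jump m j) (v j) (v′ j)))
           (∑-distrib-+ (λ j → v j ℚ.* jump m j) (λ j → v′ j ℚ.* jump m j))) ⟩
    (lz ℚ.- lx) ℚ.- (S ℚ.+ S′)
      ≡⟨ solve 5 (λ x y z a b → (z :- x) :- (a :+ b) := ((y :- x) :- a) :+ ((z :- y) :- b)) refl lx ly lz S S′ ⟩
    ((ly ℚ.- lx) ℚ.- S) ℚ.+ ((lz ℚ.- ly) ℚ.- S′) ∎
    where
    open ≡-Reasoning
    lx = level f m x
    ly = level f m y
    lz = level f m z
    S  = sum (λ j → v j ℚ.* jump m j)
    S′ = sum (λ j → v′ j ℚ.* jump m j)

  gain-reverse : ∀ m x y v → gain m y x (λ j → ℚ.- v j) ≡ ℚ.- gain m x y v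
  gain-reverse m x y v = begin
    (lx ℚ.- ly) ℚ.- sum (λ j → ℚ.- v j ℚ.* jump m j)
      ≡⟨ cong (λ S → (lx ℚ.- ly) ℚ.- S) (trans
           (sum-cong-≗ (λ j → solve 2 (λ v w → :- v :* w := con (ℚ.- 1ℚ) :* (v :* w)) refl (v j) (jump m j)))
           (sym (*-distribˡ-sum (ℚ.- 1ℚ) (λ j → v j ℚ.* jump m j)))) ⟩
    (lx ℚ.- ly) ℚ.- (ℚ.- 1ℚ) ℚ.* S
      ≡⟨ solve 3 (λ x y a → (x :- y) :- con (ℚ.- 1ℚ) :* a := :- ((y :- x) :- a)) refl lx ly S ⟩
    ℚ.- ((ly ℚ.- lx) ℚ.- S) ∎
    where
    open ≡-Reasoning
    lx = level f m x
    ly = level f m y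
    S  = sum (λ j → v j ℚ.* jump m j)

  -- Movement along a spike is controlled by the Lipschitz condition, and a wormhole step has gain
  -- exactly 0. The gluing steps force the asymptotic form, as `t ≈ 0ℝ` says nothing about any
  -- single `seq t m`.
  step-bound : ∀ {x y r} (st : Step (star s) W x y r) →
    (λ m → ℚ.∣ gain m x y (stepUsage st) ∣) ≲ seq r
  step-bound {x} {y} (along {e} {t} {u}) = pointwise λ m → begin
    ℚ.∣ gain m x y (λ _ → 0ℚ) ∣                       ≡⟨ cong ℚ.∣_∣ (gain-zero m x y) ⟩
    ℚ.∣ height f e (seq u m) ℚ.- height f e (seq t m) ∣ ≡⟨ ∣p-q∣≡∣q-p∣ (height f e (seq u m)) _ ⟩
    ℚ.∣ height f e (seq t m) ℚ.- height f e (seq u m) ∣ ≤⟨ lipschitz f e (seq t m) (seq u m) ⟩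
    ℚ.∣ seq t m ℚ.- seq u m ∣                          ∎
    where open ℚₚ.≤-Reasoning
  step-bound {x} {y} (at-source {e} {t} (t≤0 , 0≤t)) ε 0<ε =
    let (M , M-ok) = t≤0 ε 0<ε
        (N , N-ok) = 0≤t ε 0<ε
    in M ℕ.⊔ N , λ m m≥ → begin
      ℚ.∣ gain m x y (λ _ → 0ℚ) ∣                   ≡⟨ cong ℚ.∣_∣ (gain-zero m x y) ⟩
      ℚ.∣ height f e (seq t m) ℚ.- 0ℚ ∣             ≡⟨ cong (λ h → ℚ.∣ height f e (seq t m) ℚ.- h ∣) (sym (centred f e)) ⟩
      ℚ.∣ height f e (seq t m) ℚ.- height f e 0ℚ ∣  ≤⟨ lipschitz f e (seq t m) 0ℚ ⟩
      ℚ.∣ seq t m ℚ.- 0ℚ ∣                          ≤⟨ close-≤ (M-ok m (ℕₚ.m⊔n≤o⇒m≤o M N m≥)) (N-ok m (ℕₚ.m⊔n≤o⇒n≤o M N m≥)) ⟩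
      ε                                            ≡⟨ sym (ℚₚ.+-identityˡ ε) ⟩
      0ℚ ℚ.+ ε                                     ∎
    where open ℚₚ.≤-Reasoning
  step-bound {x} {y} (at-target {e} {t} (t≤1 , 1≤t)) ε 0<ε =
    let (M , M-ok) = t≤1 ε 0<ε
        (N , N-ok) = 1≤t ε 0<ε
    in M ℕ.⊔ N , λ m m≥ → begin
      ℚ.∣ gain m x y (λ _ → 0ℚ) ∣                   ≡⟨ cong ℚ.∣_∣ (gain-zero m x y) ⟩
      ℚ.∣ height f e (seq t m) ℚ.- height f e 1ℚ ∣  ≤⟨ lipschitz f e (seq t m) 1ℚ ⟩
      ℚ.∣ seq t m ℚ.- 1ℚ ∣                          ≤⟨ close-≤ (M-ok m (ℕₚ.m⊔n≤o⇒m≤o M N m≥)) (N-ok m (ℕₚ.m⊔n≤o⇒n≤o M N m≥)) ⟩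
      ε                                            ≡⟨ sym (ℚₚ.+-identityˡ ε) ⟩
      0ℚ ℚ.+ ε                                     ∎
    where open ℚₚ.≤-Reasoning
  step-bound (wormhole i) = pointwise λ m → ℚₚ.≤-reflexive (cong ℚ.∣_∣ (trans
    (cong (λ S → jump m i ℚ.- S) (sum-unit i (jump m)))
    (ℚₚ.+-inverseʳ (jump m i))))
  step-bound {x} {y} (reverse st) ε 0<ε =
    let (N , N-ok) = step-bound st ε 0<ε
    in N , λ m m≥ → ℚₚ.≤-trans (ℚₚ.≤-reflexive (trans
         (cong ℚ.∣_∣ (gain-reverse m y x (stepUsage st)))
         (ℚₚ.∣-p∣≡∣p∣ (gain m y x (stepUsage st)))))
         (N-ok m m≥)

  path-bound : ∀ {x y r} (p : Path (star s) W x y r) →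
    (λ m → ℚ.∣ gain m x y (usage p) ∣) ≲ seq r
  path-bound {x} [] = pointwise λ m → ℚₚ.≤-reflexive (cong ℚ.∣_∣ (trans
    (gain-zero m x x) (ℚₚ.+-inverseʳ (level f m x))))
  path-bound {x} {z} (_∷_ {y = y} {r = r} {r′} st p) =
    ≲-trans {b = λ m → ℚ.∣ gain m x y (stepUsage st) ∣ ℚ.+ ℚ.∣ gain m y z (usage p) ∣} {c = seq (r + r′)}
      (pointwise λ m → ℚₚ.≤-trans (ℚₚ.≤-reflexive (cong ℚ.∣_∣ (gain-+ m x y z (stepUsage st) (usage p))))
         (ℚₚ.∣p+q∣≤∣p∣+∣q∣ (gain m x y (stepUsage st)) (gain m y z (usage p))))
      (≲-+ {b = seq r} {d = seq r′} (step-bound st) (path-bound p))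

  -- For a potential that agrees on the two ends of every wormhole, the usage of the path drops out.
  path-length : (∀ m j → jump m j ≡ 0ℚ) → ∀ {x y r} → Path (star s) W x y r →
    (λ m → ℚ.∣ level f m y ℚ.- level f m x ∣) ≲ seq r
  path-length no-jump {x} {y} {r} p =
    ≲-trans {b = λ m → ℚ.∣ gain m x y (usage p) ∣} {c = seq r}
      (pointwise λ m → ℚₚ.≤-reflexive (cong ℚ.∣_∣ (sym (trans
        (cong (λ S → (level f m y ℚ.- level f m x) ℚ.- S)
          (sum-zero λ j → trans (cong (usage p j ℚ.*_) (no-jump m j)) (ℚₚ.*-zeroʳ (usage p j))))
        (ℚₚ.+-identityʳ (level f m y ℚ.- level f m x))))))
      (path-bound p)

-- Explicit paths

at : ∀ {s} (e : Fin s) q → 0ℚ ℚ.≤ q → q ℚ.≤ 1ℚ → Point (star s)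
at e q 0≤q q≤1 = on e (fromℚ q) (pointwise λ _ → 0≤q) (pointwise λ _ → q≤1)

module _ {s k} (W : Wormholes (star s) k) where

  -- The length is prescribed only as a sequence, up to pointwise equality. It can then be
  -- simplified freely, without comparing the Cauchy proofs inside reals.
  Route : Point (star s) → Point (star s) → (ℕ → ℚ) → Set
  Route x y ρ = Σ[ r ∈ ℝ ] (∀ m → seq r m ≡ ρ m) × Path (star s) W x y r

module _ {s k} {W : Wormholes (star s) k} where

  []ʳ : ∀ {x} → Route W x x (λ _ → 0ℚ)
  []ʳ = 0ℝ , (λ _ → refl) , []

  step : ∀ {x y r} → Step (star s) W x y r → Route W x y (seq r)
  step {r = r} st = r + 0ℝ , (λ m → ℚₚ.+-identityʳ (seq r m)) , _∷_ {r = r} {r′ = 0ℝ} st []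

  infixr 5 _⟫_
  _⟫_ : ∀ {x y z ρ ρ′} → Route W x y ρ → Route W y z ρ′ → Route W x z (λ m → ρ m ℚ.+ ρ′ m)
  _⟫_ {x} {y} {z} {ρ} {ρ′} (r , r≗ρ , p) R′ =
    let (r″ , r″≗ , p″) = append p R′
    in r″ , (λ m → trans (r″≗ m) (cong (ℚ._+ ρ′ m) (r≗ρ m))) , p″
    where
    append : ∀ {x y z r ρ′} → Path (star s) W x y r → Route W y z ρ′ → Route W x z (λ m → seq r m ℚ.+ ρ′ m)
    append {ρ′ = ρ′} [] (r′ , r′≗ρ′ , p′) = r′ , (λ m → trans (r′≗ρ′ m) (sym (ℚₚ.+-identityˡ (ρ′ m)))) , p′
    append {ρ′ = ρ′} (_∷_ {r = r} {r′ = q} st p) R =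
      let (r″ , r″≗ , p″) = append p R
      in r + r″ , (λ m → trans (cong (seq r m ℚ.+_) (r″≗ m)) (sym (ℚₚ.+-assoc (seq r m) (seq q m) (ρ′ m)))) , _∷_ {r = r} {r′ = r″} st p″

  relength : ∀ {x y ρ ρ′} → (∀ m → ρ m ≡ ρ′ m) → Route W x y ρ → Route W x y ρ′
  relength ρ≗ρ′ (r , r≗ρ , p) = r , (λ m → trans (r≗ρ m) (ρ≗ρ′ m)) , p

  flip : ∀ {x y ρ} → Route W x y ρ → Route W y x ρ
  flip (r , r≗ρ , p) = relength r≗ρ (go p)
    where
    go : ∀ {x y r} → Path (star s) W x y r → Route W y x (seq r)
    go [] = []ʳ
    go (_∷_ {r = r} {r′ = r′} st p) = relength
      (λ m → ℚₚ.+-comm (seq r′ m) (seq r m)) (go p ⟫ step (reverse st))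

  spoke : ∀ e q (0≤q : 0ℚ ℚ.≤ q) (q≤1 : q ℚ.≤ 1ℚ) → Route W (vertex zero) (at e q 0≤q q≤1) (λ _ → q)
  spoke e q 0≤q q≤1 = relength
    (λ _ → trans (ℚₚ.+-identityˡ _)
      (trans (∣p-q∣≡∣q-p∣ 0ℚ q)
        (trans (cong ℚ.∣_∣ (ℚₚ.+-identityʳ q)) (ℚₚ.0≤p⇒∣p∣≡p 0≤q))))
    (step {y = at e 0ℚ ℚₚ.≤-refl (ℚₚ.≤-trans 0≤q q≤1)} (at-source (pointwise (λ _ → ℚₚ.≤-refl) , pointwise (λ _ → ℚₚ.≤-refl)))
      ⟫ step along)

-- The lower bound

module Segments (s n : ℕ) (H : ℚ) (0<H : 0ℚ ℚ.< H)
                (fills : ½ ℚ.* H ℚ.+ sum {n} (λ _ → H) ≡ 1ℚ) where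

  -- The parameter `s` counts the spikes beyond the first two, which carry the two halves of the
  -- central segment.
  spikes : ℕ
  spikes = suc (suc s)

  G : MetricGraph
  G = star spikes

  -- The pieces of a spike from the centre outwards: half of the central segment, then `n` whole
  -- segments. By `fills` they exhaust the spike.
  ℓ : Fin (suc n) → ℚ
  ℓ zero    = ½ ℚ.* H
  ℓ (suc _) = H

  0≤H : 0ℚ ℚ.≤ H
  0≤H = ℚₚ.<⇒≤ 0<H

  0≤ℓ : ∀ i → 0ℚ ℚ.≤ ℓ i
  0≤ℓ zero    = ℚₚ.<⇒≤ (half-positive 0<H)
  0≤ℓ (suc _) = 0≤H

  onset+ℓ≤1 : ∀ j → onset ℓ j ℚ.+ ℓ j ℚ.≤ 1ℚ
  onset+ℓ≤1 j = ℚₚ.≤-trans (onset+ℓ≤sum ℓ 0≤ℓ j) (ℚₚ.≤-reflexive fills)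

  onset≤1 : ∀ j → onset ℓ j ℚ.≤ 1ℚ
  onset≤1 j = ℚₚ.≤-trans
    (≤-shift (0≤ℓ j) (solve 2 (λ a b → a :+ b :- a := b :- con 0ℚ) refl (onset ℓ j) (ℓ j)))
    (onset+ℓ≤1 j)

  ½H≤1 : ½ ℚ.* H ℚ.≤ 1ℚ
  ½H≤1 = subst (ℚ._≤ 1ℚ) (ℚₚ.+-identityˡ (½ ℚ.* H)) (onset+ℓ≤1 zero)

  tick : Fin (n ℕ.* spikes) → Fin n
  tick i = proj₁ (remQuot {n} spikes i)

  spike : Fin (n ℕ.* spikes) → Fin spikes
  spike i = proj₂ (remQuot {n} spikes i)

  left right : Fin (suc (n ℕ.* spikes)) → Point G
  left  zero    = at zero (½ ℚ.* H) (0≤ℓ zero) ½H≤1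
  left  (suc i) = at (spike i) (onset ℓ (suc (tick i))) (0≤onset ℓ 0≤ℓ (suc (tick i))) (onset≤1 (suc (tick i)))
  right zero    = at (suc zero) (½ ℚ.* H) (0≤ℓ zero) ½H≤1
  right (suc i) = at (spike i) (onset ℓ (suc (tick i)) ℚ.+ H)
    (ℚₚ.+-mono-≤ (0≤onset ℓ 0≤ℓ (suc (tick i))) 0≤H) (onset+ℓ≤1 (suc (tick i)))

  direct : ∀ {k} {W : Wormholes G k} i → Route W (left i) (right i) (λ _ → H)
  direct zero    = relength (λ _ → halves H)
    (flip (spoke zero (½ ℚ.* H) (0≤ℓ zero) ½H≤1) ⟫ spoke (suc zero) (½ ℚ.* H) (0≤ℓ zero) ½H≤1)
  direct (suc i) = relength
    (λ _ → trans (∣p-q∣≡∣q-p∣ a (a ℚ.+ H))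
      (trans (cong ℚ.∣_∣ (solve 2 (λ a h → a :+ h :- a := h) refl a H)) (ℚₚ.0≤p⇒∣p∣≡p 0≤H)))
    (step along)
    where a = onset ℓ (suc (tick i))

  module _ (σ : Fin (suc (n ℕ.* spikes)) → ℚ) (σ≤1 : ∀ i → ℚ.∣ σ i ∣ ℚ.≤ 1ℚ) where

    -- The central segment is traversed inwards on the first spike and outwards on the second, so
    -- the sign is reversed on the first to give slope `σ zero` throughout.
    slope : Fin spikes → Fin (suc n) → ℚ
    slope zero          zero    = ℚ.- σ zero
    slope (suc zero)    zero    = σ zero
    slope (suc (suc _)) zero    = 0ℚ
    slope e             (suc j) = σ (suc (combine j e))

    slope≤1 : ∀ e j → ℚ.∣ slope e j ∣ ℚ.≤ 1ℚ
    slope≤1 zero          zero    = subst (ℚ._≤ 1ℚ) (sym (ℚₚ.∣-p∣≡∣p∣ (σ zero))) (σ≤1 zero)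
    slope≤1 (suc zero)    zero    = σ≤1 zero
    slope≤1 (suc (suc _)) zero    = ℚₚ.nonNegative⁻¹ 1ℚ
    slope≤1 zero          (suc j) = σ≤1 _
    slope≤1 (suc zero)    (suc j) = σ≤1 _
    slope≤1 (suc (suc _)) (suc j) = σ≤1 _

    slope-suc : ∀ e j → slope e (suc j) ≡ σ (suc (combine j e))
    slope-suc zero          j = refl
    slope-suc (suc zero)    j = refl
    slope-suc (suc (suc _)) j = refl

    tilted : Potential spikes
    tilted = record
      { height    = λ e → zigzag ℓ (slope e)
      ; centred   = λ e → zigzag-zero ℓ (slope e) 0≤ℓ
      ; lipschitz = λ e → zigzag-lipschitz ℓ (slope e) (slope≤1 e)
      }

    tilted-rise : ∀ m i → level tilted m (right i) ℚ.- level tilted m (left i) ≡ σ i ℚ.* H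
    tilted-rise m zero = begin
      zigzag ℓ (slope (suc zero)) (½ ℚ.* H) ℚ.- zigzag ℓ (slope zero) (½ ℚ.* H)
        ≡⟨ cong₂ ℚ._-_ (zigzag-initial ℓ (slope (suc zero)) 0≤ℓ ℚₚ.≤-refl) (zigzag-initial ℓ (slope zero) 0≤ℓ ℚₚ.≤-refl) ⟩
      σ zero ℚ.* (½ ℚ.* H) ℚ.- (ℚ.- σ zero) ℚ.* (½ ℚ.* H)
        ≡⟨ solve 2 (λ s h → s :* (con ½ :* h) :- (:- s) :* (con ½ :* h) := s :* h) refl (σ zero) H ⟩
      σ zero ℚ.* H ∎
      where open ≡-Reasoning
    tilted-rise m (suc i) = begin
      zigzag ℓ (slope (spike i)) (onset ℓ (suc (tick i)) ℚ.+ H) ℚ.- zigzag ℓ (slope (spike i)) (onset ℓ (suc (tick i)))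
        ≡⟨ zigzag-rise ℓ (slope (spike i)) 0≤ℓ (suc (tick i)) ⟩
      slope (spike i) (suc (tick i)) ℚ.* H
        ≡⟨ cong (ℚ._* H) (slope-suc (spike i) (tick i)) ⟩
      σ (suc (combine (tick i) (spike i))) ℚ.* H
        ≡⟨ cong (λ i → σ (suc i) ℚ.* H) (combine-remQuot {n} spikes i) ⟩
      σ (suc i) ℚ.* H ∎
      where open ≡-Reasoning

  module _ (W : Wormholes G (n ℕ.* spikes)) where

    Shortcut : Fin (suc (n ℕ.* spikes)) → Set
    Shortcut i = Σ[ q ∈ ℝ ] HasPathOfLength G W (left i) (right i) q × q < fromℚ H

    -- The order of choices matters: the paths determine the usage vectors, these the coefficients
    -- `c`, and the signs of `c` the potential `f`.
    ¬all-shortcuts : ¬ (∀ i → Shortcut i)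
    ¬all-shortcuts shortcut = no-short-family c rise detour (proj₁ nonzero) (proj₂ nonzero)
      aligned (∑-bilinear c w (jump f W m) vanishes) (proj₂ late)
      where
      path : ∀ i → Path G W (left i) (right i) _
      path i = proj₂ (proj₂ (proj₁ (proj₂ (shortcut i))))
      w : Fin (suc (n ℕ.* spikes)) → Fin (n ℕ.* spikes) → ℚ
      w i = usage (path i)
      dependent = linear-dependence (n ℕ.* spikes) w
      c = proj₁ dependent
      nonzero = proj₁ (proj₂ dependent)
      vanishes = proj₂ (proj₂ dependent)
      σ : Fin (suc (n ℕ.* spikes)) → ℚ
      σ i = proj₁ (signed-abs (c i))
      f = tilted σ (λ i → proj₁ (proj₂ (signed-abs (c i))))
      -- The margin `ε` in `q < fromℚ H` absorbs the error `ε/2` of `path-bound` and keeps the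
      -- inequality strict.
      short : ∀ i → ∃[ N ] (∀ m → N ℕ.≤ m → ℚ.∣ gain f W m (left i) (right i) (w i) ∣ ℚ.< H)
      short i with shortcut i
      ... | q , (r , (r≤q , _) , p) , (ε , 0<ε , M , M-ok) =
        let (N , N-ok) = ≲-trans {b = seq r} {c = seq q} (path-bound f W p) r≤q (½ ℚ.* ε) (half-positive 0<ε)
        in M ℕ.⊔ N , λ m m≥ → ℚₚ.<-≤-trans
             (ℚₚ.≤-<-trans (N-ok m (ℕₚ.m⊔n≤o⇒n≤o M N m≥))
               (<-shift (half-positive 0<ε)
                 (solve 2 (λ q e → q :+ e :- (q :+ con ½ :* e) := con ½ :* e :- con 0ℚ) refl (seq q m) ε)))
             (M-ok m (ℕₚ.m⊔n≤o⇒m≤o M N m≥))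
      late = eventually-all {P = λ i m → ℚ.∣ gain f W m (left i) (right i) (w i) ∣ ℚ.< H} short
      m = proj₁ late
      rise detour : Fin (suc (n ℕ.* spikes)) → ℚ
      rise i   = level f m (right i) ℚ.- level f m (left i)
      detour i = sum (λ j → w i j ℚ.* jump f W m j)
      aligned : ∀ i → c i ℚ.* rise i ≡ ℚ.∣ c i ∣ ℚ.* H
      aligned i = begin
        c i ℚ.* rise i        ≡⟨ cong (c i ℚ.*_) (tilted-rise σ _ m i) ⟩
        c i ℚ.* (σ i ℚ.* H)   ≡⟨ sym (ℚₚ.*-assoc (c i) (σ i) H) ⟩
        c i ℚ.* σ i ℚ.* H     ≡⟨ cong (ℚ._* H) (proj₂ (proj₂ (signed-abs (c i)))) ⟩
        ℚ.∣ c i ∣ ℚ.* H       ∎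
        where open ≡-Reasoning

    -- Only a segment without shortcut needs a distance between its ends, and there
    -- it is H; that shortest paths exist in general is never used.
    lower-bound : ∀ δ → IsDiameter G W δ → fromℚ H ≤ δ
    lower-bound δ (_ , bound) = ≮⇒≥ δ λ δ<H →
      -- The goal is a contradiction, so it is enough that no segment lacks a shortcut: over a
      -- finite index set, double negation commutes with the universal quantifier.
      sequence (RawMonad.rawApplicative ¬¬-Monad)
        (λ i none → <⇒≱ {δ} {fromℚ H} δ<H (bound (fromℚ H) (left i , right i , geodesic i none)))
        ¬all-shortcuts
      where
      geodesic : ∀ i → ¬ Shortcut i → IsDistance G W (left i) (right i) (fromℚ H)
      geodesic i none =
        let (r , r≗H , p) = direct i
        in (r , (pointwise (ℚₚ.≤-reflexive ∘ r≗H) , pointwise (ℚₚ.≤-reflexive ∘ sym ∘ r≗H)) , p)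
         , λ q has → ≮⇒≥ q λ q<H → none (q , has , q<H)

-- The fusion

module Fusion (s n : ℕ) (H : ℚ) (0<H : 0ℚ ℚ.< H)
              (fills : ½ ℚ.* H ℚ.+ sum {n} (λ _ → H) ≡ 1ℚ) where

  open Segments s n H 0<H fills using (spikes; G; 0≤H; ½H≤1; tick; spike)

  ticks : Fin n → ℚ
  ticks _ = H

  position : Fin n → ℚ
  position j = onset ticks j ℚ.+ H

  position≤sum : ∀ j → position j ℚ.≤ sum ticks
  position≤sum = onset+ℓ≤sum ticks (λ _ → 0≤H)

  0≤½H : 0ℚ ℚ.≤ ½ ℚ.* H
  0≤½H = ℚₚ.<⇒≤ (half-positive 0<H)

  sum≤1 : sum ticks ℚ.≤ 1ℚ
  sum≤1 = ℚₚ.≤-trans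
    (≤-shift 0≤½H (solve 2 (λ a b → a :+ b :- b := a :- con 0ℚ) refl (½ ℚ.* H) (sum ticks)))
    (ℚₚ.≤-reflexive fills)

  0<position : ∀ j → 0ℚ ℚ.< position j
  0<position j = ℚₚ.+-mono-≤-< (0≤onset ticks (λ _ → 0≤H) j) 0<H

  position≤1 : ∀ j → position j ℚ.≤ 1ℚ
  position≤1 j = ℚₚ.≤-trans (position≤sum j) sum≤1

  fused : Fin (suc (n ℕ.* spikes)) → Point G
  fused zero    = vertex zero
  fused (suc i) = at (spike i) (position (tick i)) (ℚₚ.<⇒≤ (0<position (tick i))) (position≤1 (tick i))

  W : Wormholes G (n ℕ.* spikes)
  W i = fused (inject₁ i) , fused (suc i)

  -- The centre is the first fused point, so following the chain of wormholes from it reaches every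
  -- other one at no cost.
  hub : ∀ i → Route W (vertex zero) (fused i) (λ _ → 0ℚ)
  hub = <-weakInduction (λ i → Route W (vertex zero) (fused i) (λ _ → 0ℚ)) []ʳ
    λ i R → R ⟫ step (wormhole i)

  Tick : ℚ → ℚ → Set
  Tick r t = ℚ.∣ t ∣ ℚ.≤ r ⊎ ∃[ j ] ℚ.∣ t ℚ.- position j ∣ ℚ.≤ r

  -- Intervals of radius `r` around 0 and the ticks overlap because `H ≤ 2r`: a value above `r` that
  -- is lowered by `H` stays above `-r`, which allows induction on the number of ticks. The slack at
  -- both ends admits approximations outside the spike.
  nearest : ∀ {r} → ½ ℚ.* H ℚ.≤ r → ∀ {t} → ℚ.- r ℚ.≤ t → t ℚ.≤ r ℚ.+ sum ticks → Tick r t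
  nearest {r} ½H≤r = go n
    where
    lower : ∀ {t} → ℚ.- r ℚ.≤ t → ℚ.- t ℚ.≤ r
    lower {t} -r≤t = ≤-shift -r≤t (solve 2 (λ t r → r :- :- t := t :- :- r) refl t r)
    go : ∀ k {t} → ℚ.- r ℚ.≤ t → t ℚ.≤ r ℚ.+ sum {k} (λ _ → H) →
      ℚ.∣ t ∣ ℚ.≤ r ⊎ Σ[ j ∈ Fin k ] ℚ.∣ t ℚ.- (onset (λ _ → H) j ℚ.+ H) ∣ ℚ.≤ r
    go zero {t} -r≤t t≤ = inj₁ (∣-∣≤ (subst (t ℚ.≤_) (ℚₚ.+-identityʳ r) t≤) (lower -r≤t))
    go (suc k) {t} -r≤t t≤ = [ (λ t≤r → inj₁ (∣-∣≤ t≤r (lower -r≤t))) , (λ r≤t → further (go k (rest r≤t) rest′)) ]′ (ℚₚ.≤-total t r)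
      where
      rest : r ℚ.≤ t → ℚ.- r ℚ.≤ t ℚ.- H
      rest r≤t = ≤-shift (ℚₚ.+-mono-≤ r≤t (ℚₚ.+-mono-≤ ½H≤r ½H≤r))
        (solve 3 (λ t r h → t :- h :- :- r := t :+ (r :+ r) :- (r :+ (con ½ :* h :+ con ½ :* h))) refl t r H)
      rest′ : t ℚ.- H ℚ.≤ r ℚ.+ sum {k} (λ _ → H)
      rest′ = ≤-shift t≤
        (solve 4 (λ t r h s → r :+ s :- (t :- h) := r :+ (h :+ s) :- t) refl t r H (sum {k} (λ _ → H)))
      further : ℚ.∣ t ℚ.- H ∣ ℚ.≤ r ⊎ Σ[ j ∈ Fin k ] ℚ.∣ (t ℚ.- H) ℚ.- (onset (λ _ → H) j ℚ.+ H) ∣ ℚ.≤ r →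
        ℚ.∣ t ∣ ℚ.≤ r ⊎ Σ[ j ∈ Fin (suc k) ] ℚ.∣ t ℚ.- (onset (λ _ → H) j ℚ.+ H) ∣ ℚ.≤ r
      further (inj₁ close) = inj₂ (zero , subst (λ p → ℚ.∣ t ℚ.- p ∣ ℚ.≤ r) (sym (ℚₚ.+-identityˡ H)) close)
      further (inj₂ (j , close)) = inj₂ (suc j , subst (ℚ._≤ r)
        (cong ℚ.∣_∣ (solve 3 (λ t h o → t :- h :- (o :+ h) := t :- (h :+ o :+ h)) refl t H (onset {k} (λ _ → H) j)))
        close)

  -- The rational `q` stands in for the real `t` only in the choice of the tick `c`; the route
  -- itself runs from `t`.
  to-centre : ∀ {r} e q {t 0≤t t≤1} → Tick r q →
    ∃[ c ] Route W (on e t 0≤t t≤1) (vertex zero) (λ m → ℚ.∣ seq t m ℚ.- c ∣) × ℚ.∣ q ℚ.- c ∣ ℚ.≤ r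
  to-centre {r} e q (inj₁ close) = 0ℚ
    , relength (λ _ → ℚₚ.+-identityʳ _)
        (step {y = at e 0ℚ ℚₚ.≤-refl (ℚₚ.nonNegative⁻¹ 1ℚ)} along
          ⟫ flip (spoke e 0ℚ ℚₚ.≤-refl (ℚₚ.nonNegative⁻¹ 1ℚ)))
    , subst (λ p → ℚ.∣ p ∣ ℚ.≤ r) (sym (ℚₚ.+-identityʳ q)) close
  to-centre {r} e q {t} {0≤t} {t≤1} (inj₂ (j , close)) = position j
    , relength (λ _ → ℚₚ.+-identityʳ _) (along-spike (combine j e) (remQuot-combine j e) ⟫ flip (hub (suc (combine j e))))
    , close
    where
    -- The index is generalised from `combine j e`, so that matching on the equation identifies the
    -- spike and tick of `fused (suc i)` with `e` and `j`.
    along-spike : ∀ i → remQuot {n} spikes i ≡ (j , e) →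
      Route W (on e t 0≤t t≤1) (fused (suc i)) (λ m → ℚ.∣ seq t m ℚ.- position j ∣)
    along-spike i refl = step along

  leaf-route : ∀ e → ∃[ c ] Route W (vertex (suc e)) (vertex zero) (λ _ → c) × c ℚ.≤ ½ ℚ.* H
  leaf-route e =
    let (c , R , c≤) = to-centre e 1ℚ {t = 1ℝ}
          {0≤t = pointwise λ _ → ℚₚ.nonNegative⁻¹ 1ℚ} {t≤1 = pointwise λ _ → ℚₚ.≤-refl}
          (nearest ℚₚ.≤-refl
            (ℚₚ.≤-trans (ℚₚ.neg-antimono-≤ 0≤½H) (ℚₚ.nonNegative⁻¹ 1ℚ))
            (ℚₚ.≤-reflexive (sym fills)))
    in ℚ.∣ 1ℚ ℚ.- c ∣
     , relength (λ _ → ℚₚ.+-identityˡ _)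
         (step (at-target (pointwise (λ _ → ℚₚ.≤-refl) , pointwise (λ _ → ℚₚ.≤-refl))) ⟫ R)
     , c≤

  -- The tick depends on ε, as the one nearest to a real point cannot be computed.
  centre-close : ∀ x ε → 0ℚ ℚ.< ε →
    Σ[ ρ ∈ (ℕ → ℚ) ] Route W x (vertex zero) ρ × ∃[ N ] (∀ m → N ℕ.≤ m → ρ m ℚ.≤ ½ ℚ.* H ℚ.+ ε)
  centre-close (vertex zero) ε 0<ε = (λ _ → 0ℚ) , []ʳ , pointwise {b = λ _ → ½ ℚ.* H} (λ _ → 0≤½H) ε 0<ε
  centre-close (vertex (suc e)) ε 0<ε =
    let (c , R , c≤) = leaf-route e
    in (λ _ → c) , R , pointwise {b = λ _ → ½ ℚ.* H} (λ _ → c≤) ε 0<ε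
  centre-close (on e t 0≤t t≤1) ε 0<ε = (λ m → ℚ.∣ seq t m ℚ.- c ∣) , R , M , λ m m≥ → begin
    ℚ.∣ seq t m ℚ.- c ∣
      ≡⟨ cong ℚ.∣_∣ (solve 3 (λ t q c → t :- c := (t :- q) :+ (q :- c)) refl (seq t m) q c) ⟩
    ℚ.∣ (seq t m ℚ.- q) ℚ.+ (q ℚ.- c) ∣
      ≤⟨ ℚₚ.∣p+q∣≤∣p∣+∣q∣ (seq t m ℚ.- q) (q ℚ.- c) ⟩
    ℚ.∣ seq t m ℚ.- q ∣ ℚ.+ ℚ.∣ q ℚ.- c ∣
      ≤⟨ ℚₚ.+-mono-≤ (proj₂ steady m M (ℕₚ.≤-trans (ℕₚ.m≤m⊔n M₁ _) m≥) (ℕₚ.m≤m⊔n M₁ _)) q≈c ⟩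
    η ℚ.+ (½ ℚ.* H ℚ.+ η)
      ≡⟨ solve 2 (λ h e → con ½ :* e :+ (h :+ con ½ :* e) := h :+ e) refl (½ ℚ.* H) ε ⟩
    ½ ℚ.* H ℚ.+ ε ∎
    where
    open ℚₚ.≤-Reasoning
    η = ½ ℚ.* ε
    0<η : 0ℚ ℚ.< η
    0<η = half-positive 0<ε
    steady = cauchy t η 0<η
    above  = 0≤t η 0<η
    below  = t≤1 η 0<η
    M₁ = proj₁ steady
    -- Late enough that `seq t M` is within `η` of all later terms and lies between `-η` and
    -- `1 + η`.
    M  = M₁ ℕ.⊔ (proj₁ above ℕ.⊔ proj₁ below)
    q  = seq t M
    0≤q+η : 0ℚ ℚ.≤ q ℚ.+ η
    0≤q+η = proj₂ above M (ℕₚ.≤-trans (ℕₚ.m≤m⊔n (proj₁ above) (proj₁ below)) (ℕₚ.m≤n⊔m M₁ _))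
    q≤1+η : q ℚ.≤ 1ℚ ℚ.+ η
    q≤1+η = proj₂ below M (ℕₚ.≤-trans (ℕₚ.m≤n⊔m (proj₁ above) (proj₁ below)) (ℕₚ.m≤n⊔m M₁ _))
    near : Tick (½ ℚ.* H ℚ.+ η) q
    near = nearest
      (≤-shift (ℚₚ.<⇒≤ 0<η) (solve 2 (λ h e → h :+ e :- h := e :- con 0ℚ) refl (½ ℚ.* H) η))
      (≤-shift (ℚₚ.+-mono-≤ 0≤½H 0≤q+η)
        (solve 3 (λ h e q → q :- :- (h :+ e) := h :+ (q :+ e) :- (con 0ℚ :+ con 0ℚ)) refl (½ ℚ.* H) η q))
      (ℚₚ.≤-trans q≤1+η (ℚₚ.≤-reflexive (trans (cong (ℚ._+ η) (sym fills))
        (solve 3 (λ h s e → h :+ s :+ e := h :+ e :+ s) refl (½ ℚ.* H) (sum ticks) η))))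
    centre = to-centre e q {t} {0≤t} {t≤1} near
    c = proj₁ centre
    R : Route W (on e t 0≤t t≤1) (vertex zero) (λ m → ℚ.∣ seq t m ℚ.- c ∣)
    R = proj₁ (proj₂ centre)
    q≈c : ℚ.∣ q ℚ.- c ∣ ℚ.≤ ½ ℚ.* H ℚ.+ η
    q≈c = proj₂ (proj₂ centre)

  -- Any two points are joined through the centre, each being within `H/2` of it up to an
  -- arbitrarily small error.
  distance≤H : ∀ x y q → IsDistance G W x y q → q ≤ fromℚ H
  distance≤H x y q (_ , minimal) ε 0<ε =
    -- A quarter of `ε` for each of the two routes leaves half of it for the comparison with the
    -- minimum.
    let η  = ½ ℚ.* (½ ℚ.* ε)
        0<η = half-positive (half-positive 0<ε)
        (ρ , R , M , M-ok) = centre-close x η 0<η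
        (ρ′ , R′ , N , N-ok) = centre-close y η 0<η
        (r , r≗ , p) = R ⟫ flip R′
        (K , K-ok) = minimal r (r , (pointwise (λ _ → ℚₚ.≤-refl) , pointwise (λ _ → ℚₚ.≤-refl)) , p) (½ ℚ.* ε) (half-positive 0<ε)
    in K ℕ.⊔ (M ℕ.⊔ N) , λ m m≥ →
       let M⊔N≤m = ℕₚ.m⊔n≤o⇒n≤o K (M ℕ.⊔ N) m≥ in begin
       seq q m
         ≤⟨ K-ok m (ℕₚ.m⊔n≤o⇒m≤o K (M ℕ.⊔ N) m≥) ⟩
       seq r m ℚ.+ ½ ℚ.* ε
         ≡⟨ cong (ℚ._+ ½ ℚ.* ε) (r≗ m) ⟩
       ρ m ℚ.+ ρ′ m ℚ.+ ½ ℚ.* ε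
         ≤⟨ ℚₚ.+-monoˡ-≤ (½ ℚ.* ε) (ℚₚ.+-mono-≤ (M-ok m (ℕₚ.m⊔n≤o⇒m≤o M N M⊔N≤m)) (N-ok m (ℕₚ.m⊔n≤o⇒n≤o M N M⊔N≤m))) ⟩
       (½ ℚ.* H ℚ.+ η) ℚ.+ (½ ℚ.* H ℚ.+ η) ℚ.+ ½ ℚ.* ε
         ≡⟨ solve 2 (λ h e → (con ½ :* h :+ con ½ :* (con ½ :* e)) :+ (con ½ :* h :+ con ½ :* (con ½ :* e)) :+ con ½ :* e := h :+ e) refl H ε ⟩
       H ℚ.+ ε ∎
    where open ℚₚ.≤-Reasoning

  -- Rises on the last half tick of one spike and falls on that of another.
  leafward : Potential spikes
  leafward = record
    { height    = λ e → zigzag lengths (slopes e)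
    ; centred   = λ e → zigzag-zero lengths (slopes e) 0≤lengths
    ; lipschitz = λ e → zigzag-lipschitz lengths (slopes e) (slopes≤1 e)
    }
    module Leafward where
    lengths : Fin 2 → ℚ
    lengths zero    = sum ticks
    lengths (suc _) = ½ ℚ.* H
    0≤sum : 0ℚ ℚ.≤ sum ticks
    0≤sum = ℚₚ.≤-trans (ℚₚ.≤-reflexive (sym (sum-replicate-zero n))) (sum-mono-≤ {n} {λ _ → 0ℚ} (λ _ → 0≤H))
    0≤lengths : ∀ i → 0ℚ ℚ.≤ lengths i
    0≤lengths zero    = 0≤sum
    0≤lengths (suc _) = 0≤½H
    slopes : Fin spikes → Fin 2 → ℚ
    slopes _             zero    = 0ℚ
    slopes zero          (suc _) = 1ℚ
    slopes (suc zero)    (suc _) = ℚ.- 1ℚ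
    slopes (suc (suc _)) (suc _) = 0ℚ
    slopes≤1 : ∀ e i → ℚ.∣ slopes e i ∣ ℚ.≤ 1ℚ
    slopes≤1 _             zero    = ℚₚ.nonNegative⁻¹ 1ℚ
    slopes≤1 zero          (suc _) = ℚₚ.≤-refl
    slopes≤1 (suc zero)    (suc _) = ℚₚ.≤-refl
    slopes≤1 (suc (suc _)) (suc _) = ℚₚ.nonNegative⁻¹ 1ℚ

  open Leafward

  leafward-leaf : ∀ e → height leafward e 1ℚ ≡ slopes e (suc zero) ℚ.* (½ ℚ.* H)
  leafward-leaf e = begin
    zigzag lengths (slopes e) 1ℚ
      ≡⟨ cong (zigzag lengths (slopes e)) (trans (sym fills) (ℚₚ.+-comm (½ ℚ.* H) (sum ticks))) ⟩
    zigzag lengths (slopes e) (sum ticks ℚ.+ ½ ℚ.* H)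
      ≡⟨ zigzag-past lengths (slopes e) 0≤½H ⟩
    0ℚ ℚ.* sum ticks ℚ.+ zigzag (lengths ∘ suc) (slopes e ∘ suc) (½ ℚ.* H)
      ≡⟨ cong₂ ℚ._+_ (ℚₚ.*-zeroˡ (sum ticks)) (zigzag-initial (lengths ∘ suc) (slopes e ∘ suc) (0≤lengths ∘ suc) ℚₚ.≤-refl) ⟩
    0ℚ ℚ.+ slopes e (suc zero) ℚ.* (½ ℚ.* H)
      ≡⟨ ℚₚ.+-identityˡ _ ⟩
    slopes e (suc zero) ℚ.* (½ ℚ.* H) ∎
    where open ≡-Reasoning

  -- All ticks lie on the flat first piece, so this potential has no jump at any wormhole.
  leafward-fused : ∀ m i → level leafward m (fused i) ≡ 0ℚ
  leafward-fused m zero    = refl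
  leafward-fused m (suc i) = trans
    (zigzag-initial lengths (slopes (spike i)) 0≤lengths (position≤sum (tick i)))
    (ℚₚ.*-zeroˡ (position (tick i)))

  leaf leaf′ : Point G
  leaf  = vertex (suc zero)
  leaf′ = vertex (suc (suc zero))

  leaves-apart : ∀ {r} → Path G W leaf leaf′ r → fromℚ H ≤ r
  leaves-apart {r} p = ≲-trans {b = λ m → ℚ.∣ level leafward m leaf′ ℚ.- level leafward m leaf ∣} {c = seq r}
    (pointwise λ m → begin
      -- The rise of `H/2` on one spike and the fall of `H/2` on the other add up to `H`.
      H ≡⟨ solve 1 (λ h → h := :- (:- con 1ℚ :* (con ½ :* h) :- con 1ℚ :* (con ½ :* h))) refl H ⟩
      ℚ.- (ℚ.- 1ℚ ℚ.* (½ ℚ.* H) ℚ.- 1ℚ ℚ.* (½ ℚ.* H))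
        ≤⟨ -p≤∣p∣ (ℚ.- 1ℚ ℚ.* (½ ℚ.* H) ℚ.- 1ℚ ℚ.* (½ ℚ.* H)) ⟩
      ℚ.∣ ℚ.- 1ℚ ℚ.* (½ ℚ.* H) ℚ.- 1ℚ ℚ.* (½ ℚ.* H) ∣
        ≡⟨ cong₂ (λ a b → ℚ.∣ a ℚ.- b ∣) (sym (leafward-leaf (suc zero))) (sym (leafward-leaf zero)) ⟩
      ℚ.∣ level leafward m leaf′ ℚ.- level leafward m leaf ∣ ∎)
    (path-length leafward W (λ m i → cong₂ ℚ._-_ (leafward-fused m (suc i)) (leafward-fused m (inject₁ i))) p)
    where open ℚₚ.≤-Reasoning

  leaf-distance : IsDistance G W leaf leaf′ (fromℚ H)
  leaf-distance =
    let (c , R , c≤) = leaf-route zero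
        (c′ , R′ , c′≤) = leaf-route (suc zero)
        (r , r≗ , p) = R ⟫ flip R′
        r≤H = λ m → ℚₚ.≤-trans (ℚₚ.≤-reflexive (r≗ m))
                (ℚₚ.≤-trans (ℚₚ.+-mono-≤ c≤ c′≤) (ℚₚ.≤-reflexive (halves H)))
    in (r , (pointwise r≤H , leaves-apart p) , p)
     , λ q (r , (r≤q , _) , p) → ≲-trans {b = seq r} {c = seq q} (leaves-apart p) r≤q

  diameter : IsDiameter G W (fromℚ H)
  diameter = (leaf , leaf′ , leaf-distance) , λ q (x , y , d) → distance≤H x y q d

  -- Distinctness of the fused points

  spike-potential : Fin spikes → Potential spikes
  spike-potential e = record
    { height    = λ e′ t → unit e e′ ℚ.* t
    ; centred   = λ e′ → ℚₚ.*-zeroʳ (unit e e′)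
    ; lipschitz = λ e′ t u → begin
        ℚ.∣ unit e e′ ℚ.* t ℚ.- unit e e′ ℚ.* u ∣
          ≡⟨ cong ℚ.∣_∣ (solve 3 (λ a t u → a :* t :- a :* u := a :* (t :- u)) refl (unit e e′) t u) ⟩
        ℚ.∣ unit e e′ ℚ.* (t ℚ.- u) ∣
          ≤⟨ ∣*∣-mono (∣unit∣≤1 e e′) ℚₚ.≤-refl ⟩
        1ℚ ℚ.* ℚ.∣ t ℚ.- u ∣
          ≡⟨ ℚₚ.*-identityˡ _ ⟩
        ℚ.∣ t ℚ.- u ∣ ∎
    }
    where open ℚₚ.≤-Reasoning

  height-fused : Fin spikes → Fin (suc (n ℕ.* spikes)) → ℚ
  height-fused e zero    = 0ℚ
  height-fused e (suc i) = unit e (spike i) ℚ.* position (tick i)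

  level-fused : ∀ e m i → level (spike-potential e) m (fused i) ≡ height-fused e i
  level-fused e m zero    = refl
  level-fused e m (suc i) = refl

  -- `SamePoint` refers to paths without wormholes, so `path-length` applies to every potential. The
  -- heights at fused points are constant sequences, and a difference below every `ε` is 0.
  same-height : ∀ i j → SamePoint G (fused i) (fused j) → ∀ e → height-fused e i ≡ height-fused e j
  same-height i j ((r , (r≤0 , _) , p) , _) e = sym (p-q≡0⇒p≡q (ℚₚ.∣p∣≡0⇒p≡0 _ (ℚₚ.≤-antisym
    (≤-closed λ ε 0<ε → let (N , N-ok) = climb ε 0<ε in subst
      (λ d → d ℚ.≤ 0ℚ ℚ.+ ε)
      (cong₂ (λ a b → ℚ.∣ a ℚ.- b ∣) (level-fused e N j) (level-fused e N i))
      (N-ok N ℕₚ.≤-refl))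
    (ℚₚ.0≤∣p∣ _))))
    where
    climb : (λ m → ℚ.∣ level (spike-potential e) m (fused j) ℚ.- level (spike-potential e) m (fused i) ∣) ≲ (λ _ → 0ℚ)
    climb = ≲-trans {b = seq r} {c = λ _ → 0ℚ} (path-length (spike-potential e) (λ ()) (λ _ ()) p) r≤0

  own-height : ∀ i → height-fused (spike i) (suc i) ≡ position (tick i)
  own-height i = trans (cong (ℚ._* position (tick i)) (unit-diagonal (spike i))) (ℚₚ.*-identityˡ (position (tick i)))

  -- A tick has positive height for its own spike and height 0 for any other.
  same-spike : ∀ i j → (∀ e → height-fused e (suc i) ≡ height-fused e (suc j)) → spike i ≡ spike j
  same-spike i j same with spike i ≟ spike j
  ... | yes eq = eq
  ... | no i≢j = contradiction
    (trans (sym (ℚₚ.*-zeroˡ (position (tick j))))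
      (trans (cong (ℚ._* position (tick j)) (sym (unit-off-diagonal i≢j)))
        (trans (sym (same (spike i))) (own-height i))))
    (λ eq → ℚₚ.<-irrefl eq (0<position (tick i)))

  same-tick : ∀ i j → (∀ e → height-fused e (suc i) ≡ height-fused e (suc j)) → tick i ≡ tick j
  same-tick i j same = onset-injective 0<H (tick i) (tick j) (+-cancelʳ H _ _ (begin
    position (tick i)               ≡⟨ sym (own-height i) ⟩
    height-fused (spike i) (suc i)  ≡⟨ same (spike i) ⟩
    height-fused (spike i) (suc j)  ≡⟨ cong (λ e → height-fused e (suc j)) (same-spike i j same) ⟩
    height-fused (spike j) (suc j)  ≡⟨ own-height j ⟩
    position (tick j)               ∎))
    where open ≡-Reasoning

  distinct : ∀ i j → SamePoint G (fused i) (fused j) → i ≡ j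
  distinct zero    zero    same = refl
  distinct zero    (suc j) same = contradiction
    (trans (same-height zero (suc j) same (spike j)) (own-height j))
    (λ eq → ℚₚ.<-irrefl eq (0<position (tick j)))
  distinct (suc i) zero    same = contradiction
    (trans (sym (same-height (suc i) zero same (spike i))) (own-height i))
    (λ eq → ℚₚ.<-irrefl eq (0<position (tick i)))
  distinct (suc i) (suc j) same = cong suc (begin
    i                           ≡⟨ sym (combine-remQuot {n} spikes i) ⟩
    combine (tick i) (spike i)  ≡⟨ cong₂ combine (same-tick i j heights) (same-spike i j heights) ⟩
    combine (tick j) (spike j)  ≡⟨ combine-remQuot {n} spikes j ⟩
    j                           ∎)
    where
    open ≡-Reasoning
    heights = same-height (suc i) (suc j) same

  isFusion : IsFusion G W
  isFusion = fused , distinct , λ _ → refl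

-- Arithmetic of the length 2/(2n+1)

/-distrib-+ : ∀ i j d → (i ℤ.+ j) / suc d ≡ i / suc d ℚ.+ j / suc d
-- Since `_/_` reduces to lowest terms, the identity is checked by cross-multiplication of
-- unnormalised fractions.
/-distrib-+ i j d = ℚₚ.toℚᵘ-injective (begin
  ℚ.toℚᵘ ((i ℤ.+ j) / suc d)                     ≈⟨ ℚₚ.toℚᵘ-fromℚᵘ (mkℚᵘ (i ℤ.+ j) d) ⟩
  mkℚᵘ (i ℤ.+ j) d                               ≈⟨ *≡* (solveℤ 3 (λ i j d → (i ⊕ j) ⊗ (d ⊗ d) ⊜ (i ⊗ d ⊕ j ⊗ d) ⊗ d) refl i j (+ suc d)) ⟩
  mkℚᵘ i d ℚᵘ.+ mkℚᵘ j d                         ≈⟨ ℚᵘₚ.+-cong (ℚₚ.toℚᵘ-fromℚᵘ (mkℚᵘ i d)) (ℚₚ.toℚᵘ-fromℚᵘ (mkℚᵘ j d)) ⟨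
  ℚ.toℚᵘ (i / suc d) ℚᵘ.+ ℚ.toℚᵘ (j / suc d)     ≈⟨ ℚₚ.toℚᵘ-homo-+ (i / suc d) (j / suc d) ⟨
  ℚ.toℚᵘ (i / suc d ℚ.+ j / suc d)               ∎)
  where
  open ℚᵘₚ.≃-Reasoning
  open ℤ-Solver using () renaming (solve to solveℤ; _:+_ to _⊕_; _:*_ to _⊗_; _:=_ to _⊜_)

n/n≡1 : ∀ d → + suc d / suc d ≡ 1ℚ
n/n≡1 d = ℚₚ.fromℚᵘ-cong {mkℚᵘ (+ suc d) d} {mkℚᵘ (+ 1) 0} (*≡* (ℤₚ.*-comm (+ suc d) (+ 1)))

tick-length : ℕ → ℚ
tick-length n = + 2 / suc (2 ℕ.* n)

0<tick-length : ∀ n → 0ℚ ℚ.< tick-length n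
0<tick-length n = ℚₚ.positive⁻¹ (tick-length n) {{ℚₚ.normalize-pos 2 (suc (2 ℕ.* n))}}

sum-const : ∀ m d → sum {m} (λ _ → + 2 / suc d) ≡ + (m ℕ.* 2) / suc d
sum-const zero    d = sym (ℚₚ.0/n≡0 (suc d))
sum-const (suc m) d = trans (cong (+ 2 / suc d ℚ.+_) (sum-const m d))
  (sym (/-distrib-+ (+ 2) (+ (m ℕ.* 2)) d))

ticks-fill : ∀ n → ½ ℚ.* tick-length n ℚ.+ sum {n} (λ _ → tick-length n) ≡ 1ℚ
ticks-fill n = begin
  ½ ℚ.* (+ 2 / suc d) ℚ.+ sum {n} (λ _ → + 2 / suc d)
    -- Writing the numerator 2 as 1 + 1 lets the solver halve it.
    ≡⟨ cong₂ (λ a b → ½ ℚ.* a ℚ.+ b) (/-distrib-+ (+ 1) (+ 1) d) (sum-const n d) ⟩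
  ½ ℚ.* (+ 1 / suc d ℚ.+ + 1 / suc d) ℚ.+ + (n ℕ.* 2) / suc d
    ≡⟨ cong (ℚ._+ + (n ℕ.* 2) / suc d) (solve 1 (λ a → con ½ :* (a :+ a) := a) refl (+ 1 / suc d)) ⟩
  + 1 / suc d ℚ.+ + (n ℕ.* 2) / suc d
    ≡⟨ sym (/-distrib-+ (+ 1) (+ (n ℕ.* 2)) d) ⟩
  + suc (n ℕ.* 2) / suc d
    ≡⟨ cong (λ k → + suc k / suc d) (ℕₚ.*-comm n 2) ⟩
  + suc d / suc d
    ≡⟨ n/n≡1 d ⟩
  1ℚ ∎
  where
  open ≡-Reasoning
  d = 2 ℕ.* n

mainTheorem10 : ∀ (s n : ℕ) → 2 ℕ.≤ s → 1 ℕ.≤ n →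
    (∀ (W : Wormholes (star s) (n ℕ.* s)) (δ : ℝ) →
    IsDiameter (star s) W δ → fromℚ (+ 2 / suc (2 ℕ.* n)) ≤ δ)
    ×
    (Σ[ W ∈ Wormholes (star s) (n ℕ.* s) ]
    IsDiameter (star s) W (fromℚ (+ 2 / suc (2 ℕ.* n))) ×
    IsFusion (star s) W)
mainTheorem10 (suc (suc s)) n (ℕ.s≤s (ℕ.s≤s _)) _ = lower-bound , W , diameter , isFusion
  where
  open Segments s n (tick-length n) (0<tick-length n) (ticks-fill n) using (lower-bound)
  open Fusion s n (tick-length n) (0<tick-length n) (ticks-fill n) using (W; diameter; isFusion)
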